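{- Let $H$ be a finite graph without multiple edges, possibly with loops, with no isolated vertices, and with maximum degree $\Delta$ (loops counting once toward the degree). Let $n\geq 2$ and $G \in \mathcal{G}(n,1)$. \begin{enumerate} \item Suppose that $H \neq K_{\Delta}^{\text{loop}}$ and $\hom(K_2,H) \geq \Delta^2$. Then \[ \hom(G,H) \leq \hom(K_2,H)^{\frac{n}{2}}, \] with equality only for $G = \frac{n}{2} K_{2}$. \item Suppose that $\hom(K_2,H) < \Delta^2$, and let $n_0 = n_0(H)$ be the smallest integer in $\{3,4,\ldots\}$ satisfying $\hom(K_2,H) < \hom(K_{1,n_0-1},H)^{\frac{2}{n_0}}$. \begin{enumerate} \item If $2 \leq n < n_0$, then \[ \hom(G,H) \leq \hom(K_{2},H)^{\frac{n}{2}}, \] with equality only for $G=\frac{n}{2} K_2$, unless $n=n_0-1$ and $\hom(K_2,H) = \hom(K_{1,n_0-2},H)^{\frac{2}{n_0-1}}$, in which case $G = K_{1,n-1}$ also achieves equality. \item If $n \geq n_0$, then \[ \hom(G,H) \leq \hom(K_{1,n-1},H), \] with equality only for $G = K_{1,n-1}$. \end{enumerate} \end{enumerate}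
   Context: For a finite simple (loopless) graph $G$ and a finite graph $H$ (no multiple edges, loops allowed), $\hom(G,H)$ is the number of maps $f:V(G)\to V(H)$ such that $v\sim_G w$ implies $f(v)\sim_H f(w)$. For $v\in V(H)$, $d(v)$ is the degree of $v$, where a loop counts once; $\Delta=\max_{v\in V(H)} d(v)$. A vertex of $H$ is isolated if it is incident to no edge and no loop. $\mathcal{G}(n,\delta)$ is the set of all $n$-vertex finite simple graphs with minimum degree (exactly) $\delta$. $K_\Delta^{\text{loop}}$ is the fully looped complete graph on $\Delta$ vertices. $K_{a,b}$ is the complete bipartite graph with parts of sizes $a$ and $b$. $\frac{n}{2}K_2$ is the disjoint union of $n/2$ copies of $K_2$ (it exists only when $2\mid n$). Graph equality is up to isomorphism. -}

module Defs where

open import Data.Empty using (⊥)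
open import Data.Fin.Base using (Fin; splitAt; quotient; remainder; finToFun)
import Data.Fin.Properties as Fin
open import Data.List.Base using (map; allFin)
open import Data.List.Extrema.Nat using (max)
open import Data.Nat.Base using (ℕ; _+_; _*_; _^_; _∸_; _≤_; _<_)
open import Data.Nat.Divisibility using (_∣_)
open import Data.Product.Base using (Σ-syntax; ∃; _×_; _,_)
open import Data.Sum.Base using (_⊎_; inj₁; inj₂)
open import Data.Unit.Base using (⊤; tt)
import Data.Vec.Base as Vec
open import Function.Base using (_∘_)
open import Function.Bundles using (_↔_; _⇔_; Inverse)
open import Level using (0ℓ)
open import Relation.Binary.Core using (Rel)
open import Relation.Binary.Definitions using (Decidable; Irreflexive; Symmetric)
open import Relation.Binary.PropositionalEquality using (_≡_; refl; sym)
open import Relation.Nullary using (Dec; yes; no; ¬_)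
open import Relation.Nullary.Decidable using (_×-dec_; _→-dec_; ¬?)
import Relation.Unary as Unary

-- Loops are allowed: a loop at v is a proof of Adj v v.
record Graph (n : ℕ) : Set₁ where
  field
    Adj     : Rel (Fin n) 0ℓ
    adj?    : Decidable Adj
    adj-sym : Symmetric Adj

open Graph public

record SimpleGraph (n : ℕ) : Set₁ where
  field
    graph    : Graph n
    loopless : Irreflexive _≡_ (Adj graph)

open SimpleGraph public

infix 4 _≅_

record _≅_ {m n : ℕ} (G : Graph m) (H : Graph n) : Set where
  field
    vertices : Fin m ↔ Fin n
    adjacent : ∀ u v → Adj G u v ⇔ Adj H (Inverse.to vertices u) (Inverse.to vertices v)

countFin : ∀ {n} {P : Fin n → Set} → Unary.Decidable P → ℕ
countFin {n} P? = Vec.count P? (Vec.allFin n)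

-- The neighbourhood of a looped vertex v contains v once, so a loop adds one.
degree : ∀ {n} → Graph n → Fin n → ℕ
degree G v = countFin (adj? G v)

maxDegree : ∀ {n} → Graph n → ℕ
maxDegree {n} G = max 0 (map (degree G) (allFin n))

HasMinDegree : ∀ {n} → Graph n → ℕ → Set
HasMinDegree G δ = (∀ v → δ ≤ degree G v) × ∃ λ v → degree G v ≡ δ

Isolated : ∀ {n} → Graph n → Fin n → Set
Isolated G v = ∀ w → ¬ Adj G v w

IsHom : ∀ {n m} → SimpleGraph n → Graph m → (Fin n → Fin m) → Set
IsHom G H f = ∀ v w → Adj (graph G) v w → Adj H (f v) (f w)

isHom? : ∀ {n m} (G : SimpleGraph n) (H : Graph m) → Unary.Decidable (IsHom G H)
isHom? G H f = Fin.all? λ v → Fin.all? λ w → adj? (graph G) v w →-dec adj? H (f v) (f w)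

-- finToFun enumerates the m ^ n maps Fin n → Fin m, each exactly once
-- up to pointwise equality.
hom : ∀ {n m} → SimpleGraph n → Graph m → ℕ
hom {n} {m} G H = countFin {m ^ n} (isHom? G H ∘ finToFun)

K : (n : ℕ) → SimpleGraph n
K n = record
  { graph = record
    { Adj     = λ u v → ¬ u ≡ v
    ; adj?    = λ u v → ¬? (u Fin.≟ v)
    ; adj-sym = λ u≢v → u≢v ∘ sym
    }
  ; loopless = λ u≡v u≢v → u≢v u≡v
  }

Kˡᵒᵒᵖ : (n : ℕ) → Graph n
Kˡᵒᵒᵖ n = record
  { Adj     = λ _ _ → ⊤
  ; adj?    = λ _ _ → yes tt
  ; adj-sym = λ _ → tt
  }

OppositeSides : {A B : Set} → A ⊎ B → A ⊎ B → Set
OppositeSides (inj₁ _) (inj₁ _) = ⊥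
OppositeSides (inj₁ _) (inj₂ _) = ⊤
OppositeSides (inj₂ _) (inj₁ _) = ⊤
OppositeSides (inj₂ _) (inj₂ _) = ⊥

oppositeSides? : {A B : Set} (x y : A ⊎ B) → Dec (OppositeSides x y)
oppositeSides? (inj₁ _) (inj₁ _) = no λ ()
oppositeSides? (inj₁ _) (inj₂ _) = yes tt
oppositeSides? (inj₂ _) (inj₁ _) = yes tt
oppositeSides? (inj₂ _) (inj₂ _) = no λ ()

oppositeSides-sym : {A B : Set} (x y : A ⊎ B) → OppositeSides x y → OppositeSides y x
oppositeSides-sym (inj₁ _) (inj₂ _) _ = tt
oppositeSides-sym (inj₂ _) (inj₁ _) _ = tt

oppositeSides-irrefl : {A B : Set} (x : A ⊎ B) → ¬ OppositeSides x x
oppositeSides-irrefl (inj₁ _) ()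
oppositeSides-irrefl (inj₂ _) ()

K[_,_] : (a b : ℕ) → SimpleGraph (a + b)
K[ a , b ] = record
  { graph = record
    { Adj     = λ u v → OppositeSides (splitAt a u) (splitAt a v)
    ; adj?    = λ u v → oppositeSides? (splitAt a u) (splitAt a v)
    ; adj-sym = λ {u} {v} → oppositeSides-sym (splitAt a u) (splitAt a v)
    }
  ; loopless = λ { {u} refl → oppositeSides-irrefl (splitAt a u) }
  }

-- Disjoint union of k copies of G: under Fin (k * n) ≅ Fin k × Fin n the
-- first component is the index of the copy, the second the vertex of G.
copies : ∀ {n} (k : ℕ) → SimpleGraph n → SimpleGraph (k * n)
copies {n} k G = record
  { graph = record
    { Adj     = λ u v → copy u ≡ copy v × Adj (graph G) (vertex u) (vertex v)
    ; adj?    = λ u v → (copy u Fin.≟ copy v) ×-dec adj? (graph G) (vertex u) (vertex v)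
    ; adj-sym = λ (p , q) → sym p , adj-sym (graph G) q
    }
  ; loopless = λ { refl (_ , q) → loopless G refl q }
  }
  where
  copy : Fin (k * n) → Fin k
  copy = quotient n
  vertex : Fin (k * n) → Fin n
  vertex = remainder {k} n

-- G = (n/2) K₂, which is false for odd n.
IsHalfK₂ : ∀ {n} → SimpleGraph n → Set
IsHalfK₂ {n} G = Σ[ 2∣n ∈ 2 ∣ n ] graph G ≅ graph (copies (_∣_.quotient 2∣n) (K 2))

-- G = K_{1,n-1}; used only for n ≥ 2, so the truncated subtraction is exact.
IsStar : ∀ {n} → SimpleGraph n → Set
IsStar {n} G = graph G ≅ graph K[ 1 , n ∸ 1 ]

-- Comparison of x with the real number y^(p/q), for q > 0: both sides are
-- nonnegative and t ↦ t^q is strictly increasing on the nonnegative reals.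
-- For q = 0 these do not have the intended meaning.
infix 4 _≤ʳ_^⟨_/_⟩ _<ʳ_^⟨_/_⟩ _≡ʳ_^⟨_/_⟩

_≤ʳ_^⟨_/_⟩ : ℕ → ℕ → ℕ → ℕ → Set
x ≤ʳ y ^⟨ p / q ⟩ = x ^ q ≤ y ^ p

_<ʳ_^⟨_/_⟩ : ℕ → ℕ → ℕ → ℕ → Set
x <ʳ y ^⟨ p / q ⟩ = x ^ q < y ^ p

_≡ʳ_^⟨_/_⟩ : ℕ → ℕ → ℕ → ℕ → Set
x ≡ʳ y ^⟨ p / q ⟩ = x ^ q ≡ y ^ p

IsLeast : (ℕ → Set) → ℕ → Set
IsLeast P k = P k × (∀ j → P j → k ≤ j)

-- n₀(H) is the least k satisfying this.
StarBeatsEdges : ∀ {m} → Graph m → ℕ → Set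
StarBeatsEdges H k = 3 ≤ k × hom (K 2) H <ʳ hom K[ 1 , k ∸ 1 ] H ^⟨ 2 / k ⟩

-- Inserting the vertices of G one at a time into a family of vertex-disjoint stars shows that G
-- contains a spanning forest of stars with a_i ≥ 2 vertices.  Restricting homomorphisms to it gives
-- hom(G,H) ≤ ∏ σ(a_i - 1), where σ(p) = ∑ d(v)^p = hom(K_{1,p},H).  Power sums are log-convex, so
-- the ratio f(a) = σ(a - 1) / σ(1)^(a/2), which is 1 at a = 2, stays at most 1 until it first exceeds
-- 1 at a = n₀, and increases strictly from a = n₀ - 1 on.  Hence below n₀ the product is at most
-- σ(1)^(n/2), and from n₀ on merging two stars into one strictly increases the bound.  If
-- hom(K₂,H) ≥ Δ² and H is not a complete looped graph, then f(a) < 1 for all a ≥ 3.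
--
-- For the equality cases, an edge of G outside the forest destroys a homomorphism of the forest:
-- in a perfect matching because H has two non-adjacent vertices, in a star because H has two
-- non-adjacent vertices with a common neighbour.
module Submission where

open import Data.Empty using (⊥)
open import Data.Fin.Base using (Fin; zero; suc; splitAt; join; _↑ˡ_; _↑ʳ_; combine; quotient; remainder; finToFun; funToFin)
open import Data.Fin.Permutation using (↔⇒≡)
import Data.Fin.Properties as Fin
open import Data.List.Base as List using (List; []; _∷_; lookup; length; allFin)
open import Data.List.Extrema.Nat using (xs≤max; max≤v⁺; argmax-sel)
import Data.List.Membership.DecPropositional as DecMembership
open import Data.List.Membership.Propositional using (_∈_; _∉_)
open import Data.List.Membership.Propositional.Properties using (∈-++⁺ˡ; ∈-++⁺ʳ; ∈-++⁻; ∈-∃++; ∈-lookup; ∈-allFin; ∈-map⁺; ∈-map⁻)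
open import Data.List.Relation.Binary.Permutation.Propositional using (_↭_; ↭-refl; ↭-sym; ↭-trans; ↭-prep; ↭-swap; ↭⇒↭ₛ)
open import Data.List.Relation.Binary.Permutation.Propositional.Properties using (∈-resp-↭; shift; ++⁺ˡ; ++⁺ʳ)
import Data.List.Relation.Binary.Permutation.Setoid.Properties as Permutationₛ
open import Data.List.Relation.Unary.All as All using (All; []; _∷_)
import Data.List.Relation.Unary.All.Properties as All
open import Data.List.Relation.Unary.AllPairs using ([]; _∷_)
open import Data.List.Relation.Unary.Any as Any using (here; there)
open import Data.List.Relation.Unary.Any.Properties using (lookup-index)
open import Data.List.Relation.Unary.Unique.Propositional using (Unique)
open import Data.Nat.Base hiding (_/_)
open import Data.Nat.Divisibility using (divides)
open import Data.Nat.ListAction using (product)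
open import Data.Nat.Properties
open import Data.Nat.Tactic.RingSolver using (solve-∀)
open import Data.Product.Base using (_×_; _,_; proj₁; proj₂; Σ-syntax; ∃-syntax)
open import Data.Sum.Base as Sum using (_⊎_; inj₁; inj₂; [_,_]′)
open import Data.Sum.Function.Propositional using (_⊎-↔_)
open import Data.Unit.Base using (tt)
import Data.Vec.Base as Vec
open import Data.Vec.Functional using (Vector; _++_) renaming (_∷_ to infixr 5 _◂_)
import Data.Vec.Properties as Vec
open import Function.Base using (_∘_; id)
open import Function.Bundles using (_↔_; _⇔_; Inverse; Equivalence; mk⇔; mk↔ₛ′; mk⤖)
open import Function.Construct.Composition using (_↔-∘_)
open import Function.Construct.Identity using (↔-id)
open import Function.Construct.Symmetry using (↔-sym)
open import Function.Properties.Bijection using (⤖⇒↔)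
open import Relation.Binary.PropositionalEquality
open import Relation.Nullary using (Dec; yes; no; ¬_; does; contradiction)
open import Relation.Nullary.Decidable using (_×-dec_; ¬?; decidable-stable)
import Relation.Unary as Unary
open import Algebra.Properties.Semiring.Sum +-*-semiring
open import Data.Bool.Base using (true; false; if_then_else_)
open import Defs

private variable
  m n a b k : ℕ
  A B : Set

-- Counting homomorphisms

indicator : Dec A → ℕ
indicator p? = if does p? then 1 else 0

indicator-mono : (p? : Dec A) (q? : Dec B) → (A → B) → indicator p? ≤ indicator q?
indicator-mono (no _)  _       _   = z≤n
indicator-mono (yes _) (yes _) _   = ≤-refl
indicator-mono (yes p) (no ¬q) p⇒q = contradiction (p⇒q p) ¬q

indicator-cong : (p? : Dec A) (q? : Dec B) → (A → B) → (B → A) → indicator p? ≡ indicator q?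
indicator-cong p? q? to from = ≤-antisym (indicator-mono p? q? to) (indicator-mono q? p? from)

indicator-< : (p? : Dec A) (q? : Dec B) → ¬ A → B → indicator p? < indicator q?
indicator-< (yes p) _       ¬p _ = contradiction p ¬p
indicator-< (no _)  (yes _) _  _ = ≤-refl
indicator-< (no _)  (no ¬q) _  q = contradiction q ¬q

indicator-× : (p? : Dec A) (q? : Dec B) → indicator (p? ×-dec q?) ≡ indicator p? * indicator q?
indicator-× (yes _) (yes _) = refl
indicator-× (yes _) (no _)  = refl
indicator-× (no _)  _       = refl

sum-mono-≤ : {f g : Vector ℕ n} → (∀ i → f i ≤ g i) → sum f ≤ sum g
sum-mono-≤ {zero}  _   = z≤n
sum-mono-≤ {suc n} f≤g = +-mono-≤ (f≤g zero) (sum-mono-≤ (f≤g ∘ suc))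

sum-mono-< : {f g : Vector ℕ n} → (∀ i → f i ≤ g i) → ∀ i → f i < g i → sum f < sum g
sum-mono-< f≤g zero    f<g = +-mono-<-≤ f<g (sum-mono-≤ (f≤g ∘ suc))
sum-mono-< f≤g (suc i) f<g = +-mono-≤-< (f≤g zero) (sum-mono-< (f≤g ∘ suc) i f<g)

sum-const : ∀ n c → sum {n} (λ _ → c) ≡ n * c
sum-const zero    c = refl
sum-const (suc n) c = cong (c +_) (sum-const n c)

sum-splitAt : ∀ a (f : Vector ℕ (a + b)) → sum f ≡ sum (λ i → f (i ↑ˡ b)) + sum (λ j → f (a ↑ʳ j))
sum-splitAt zero    f = refl
sum-splitAt (suc a) f = trans (cong (f zero +_) (sum-splitAt a (f ∘ suc))) (sym (+-assoc (f zero) _ _))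

sum-combine : ∀ a (f : Vector ℕ (a * b)) → sum f ≡ ∑[ i < a ] ∑[ j < b ] f (combine i j)
sum-combine         zero    f = refl
sum-combine {b = b} (suc a) f =
  trans (sum-splitAt b f) (cong (sum {b} (λ j → f (combine {suc a} zero j)) +_) (sum-combine a (f ∘ (b ↑ʳ_))))

count-tabulate : {P : A → Set} (P? : Unary.Decidable P) (f : Fin n → A) →
  Vec.count P? (Vec.tabulate f) ≡ sum (indicator ∘ P? ∘ f)
count-tabulate {n = zero}  P? f = refl
count-tabulate {n = suc n} P? f with does (P? (f zero))
... | true  = cong suc (count-tabulate P? (f ∘ suc))
... | false = count-tabulate P? (f ∘ suc)

countFin-sum : {P : Fin n → Set} (P? : Unary.Decidable P) → countFin P? ≡ sum (indicator ∘ P?)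
countFin-sum P? = count-tabulate P? id

-- Pointwise equal maps need not be propositionally equal, so sums over maps are reindexed only for
-- summands that respect `≗`.
Extensional : ((Fin n → Fin m) → ℕ) → Set
Extensional F = ∀ f g → f ≗ g → F f ≡ F g

◂-cong : (x : A) {f g : Vector A n} → f ≗ g → (x ◂ f) ≗ (x ◂ g)
◂-cong x f≗g zero    = refl
◂-cong x f≗g (suc i) = f≗g i

funToFin-cong : {f g : Fin n → Fin m} → f ≗ g → funToFin f ≡ funToFin g
funToFin-cong {zero}  _   = refl
funToFin-cong {suc n} f≗g = cong₂ combine (f≗g zero) (funToFin-cong (f≗g ∘ suc))

finToFun∘-inverse : ∀ {c} (φ : Fin b → Fin a) (ψ : Fin a → Fin b) → (∀ i → ψ (φ i) ≡ i) → ∀ (i : Fin (c ^ b)) →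
  funToFin (finToFun {c} {a} (funToFin (finToFun {c} {b} i ∘ ψ)) ∘ φ) ≡ i
finToFun∘-inverse {b} {a} {c} φ ψ ψφ i = trans
  (funToFin-cong λ j → trans (Fin.finToFun-funToFin (finToFun {c} {b} i ∘ ψ) (φ j)) (cong (finToFun i) (ψφ j)))
  (Fin.funToFin-finToFin {b} {c} i)

-- Sums over maps run over `m ^ n` codes, as in `hom`. They stay opaque so that later goals mention
-- only maps and never their codes.
opaque

  ∑ᶠ : ((Fin n → Fin m) → ℕ) → ℕ
  ∑ᶠ {n} {m} F = sum {m ^ n} (λ i → F (finToFun i))

  ∑ᶠ-cong : {F G : (Fin n → Fin m) → ℕ} → (∀ f → F f ≡ G f) → ∑ᶠ F ≡ ∑ᶠ G
  ∑ᶠ-cong F≡G = sum-cong-≗ λ i → F≡G (finToFun i)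

  ∑ᶠ-mono-≤ : {F G : (Fin n → Fin m) → ℕ} → (∀ f → F f ≤ G f) → ∑ᶠ F ≤ ∑ᶠ G
  ∑ᶠ-mono-≤ F≤G = sum-mono-≤ λ i → F≤G (finToFun i)

  ∑ᶠ-mono-< : {F G : (Fin n → Fin m) → ℕ} → Extensional F → Extensional G →
    (∀ f → F f ≤ G f) → ∀ f → F f < G f → ∑ᶠ F < ∑ᶠ G
  ∑ᶠ-mono-< F-ext G-ext F≤G f F<G = sum-mono-< (λ i → F≤G (finToFun i)) (funToFin f)
    (subst₂ _<_ (F-ext _ _ (sym ∘ Fin.finToFun-funToFin f)) (G-ext _ _ (sym ∘ Fin.finToFun-funToFin f)) F<G)

  ∑ᶠ-*ˡ : ∀ c (F : (Fin n → Fin m) → ℕ) → ∑ᶠ (λ f → c * F f) ≡ c * ∑ᶠ F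
  ∑ᶠ-*ˡ c F = sym (*-distribˡ-sum c (λ i → F (finToFun i)))

  ∑ᶠ-*ʳ : ∀ c (F : (Fin n → Fin m) → ℕ) → ∑ᶠ (λ f → F f * c) ≡ ∑ᶠ F * c
  ∑ᶠ-*ʳ c F = sym (*-distribʳ-sum c (λ i → F (finToFun i)))

  ∑ᶠ-zero : (F : (Fin 0 → Fin m) → ℕ) (f : Fin 0 → Fin m) → Extensional F → ∑ᶠ F ≡ F f
  ∑ᶠ-zero F f ext = trans (+-identityʳ _) (ext _ _ λ ())

  ∑ᶠ-suc : (F : (Fin (suc n) → Fin m) → ℕ) → Extensional F →
    ∑ᶠ F ≡ ∑[ x < m ] ∑ᶠ (λ f → F (x ◂ f))
  ∑ᶠ-suc {n} {m} F ext = trans (sum-combine m (λ i → F (finToFun i)))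
    (sum-cong-≗ λ x → sum-cong-≗ λ i → ext _ _ (head-tail x i))
    where
    head-tail : ∀ x i → finToFun {m} {suc n} (combine x i) ≗ (x ◂ finToFun i)
    head-tail x i zero    = cong proj₁ (Fin.remQuot-combine x i)
    head-tail x i (suc j) = cong (λ p → finToFun (proj₂ p) j) (Fin.remQuot-combine x i)

  -- Precomposition with a bijection of the domains is a bijection between the maps, hence between
  -- their codes.
  ∑ᶠ-permute : (φ : Fin a ↔ Fin b) (F : (Fin a → Fin m) → ℕ) → Extensional F →
    ∑ᶠ F ≡ ∑ᶠ λ g → F (g ∘ Inverse.to φ)
  ∑ᶠ-permute {a} {b} {m} φ F ext = trans (∑-permute (λ i → F (finToFun i)) π)
    (sum-cong-≗ λ i → ext _ _ (Fin.finToFun-funToFin {a} (finToFun {m} {b} i ∘ to)))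
    where
    open Inverse φ
    π : Fin (m ^ b) ↔ Fin (m ^ a)
    π = mk↔ₛ′ (λ i → funToFin (finToFun {m} {b} i ∘ to)) (λ i → funToFin (finToFun {m} {a} i ∘ from))
          (finToFun∘-inverse to from strictlyInverseʳ) (finToFun∘-inverse from to strictlyInverseˡ)

  countFin-∑ᶠ : {P : (Fin n → Fin m) → Set} (P? : Unary.Decidable P) →
    countFin {m ^ n} (λ i → P? (finToFun i)) ≡ ∑ᶠ (λ f → indicator (P? f))
  countFin-∑ᶠ P? = countFin-sum (λ i → P? (finToFun i))

∑ᶠ-++ : ∀ a {b} (F : (Fin (a + b) → Fin m) → ℕ) → Extensional F →
  ∑ᶠ F ≡ ∑ᶠ λ f → ∑ᶠ λ g → F (_++_ {m = a} {n = b} f g)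
∑ᶠ-++         zero    {b} F ext =
  sym (∑ᶠ-zero (λ f → ∑ᶠ λ g → F (_++_ {m = 0} {n = b} f g)) (λ ()) λ _ _ _ → refl)
∑ᶠ-++ {m = m} (suc a) {b} F ext = begin
  ∑ᶠ F                                              ≡⟨ ∑ᶠ-suc F ext ⟩
  ∑[ x < m ] ∑ᶠ (λ h → F (x ◂ h))
    ≡⟨ sum-cong-≗ (λ x → ∑ᶠ-++ a (F ∘ (x ◂_)) λ f g f≗g → ext _ _ (◂-cong x f≗g)) ⟩
  ∑[ x < m ] ∑ᶠ (λ f → ∑ᶠ λ g → F (x ◂ (_++_ {m = a} {n = b} f g)))
    ≡⟨ sum-cong-≗ (λ x → ∑ᶠ-cong λ f → ∑ᶠ-cong λ g → ext _ _ (◂-++ x f g)) ⟩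
  ∑[ x < m ] ∑ᶠ (λ f → F′ (x ◂ f))
    ≡⟨ ∑ᶠ-suc F′ (λ f f′ f≗f′ → ∑ᶠ-cong λ g → ext _ _ (++-congˡ f f′ g f≗f′)) ⟨
  ∑ᶠ F′                                             ∎
  where
  open ≡-Reasoning
  F′ : (Fin (suc a) → Fin m) → ℕ
  F′ f = ∑ᶠ λ g → F (_++_ {m = suc a} {n = b} f g)
  ◂-++ : ∀ x (f : Vector (Fin m) a) (g : Vector (Fin m) b) → (x ◂ (f ++ g)) ≗ ((x ◂ f) ++ g)
  ◂-++ x f g zero = refl
  ◂-++ x f g (suc i) with splitAt a i
  ... | inj₁ _ = refl
  ... | inj₂ _ = refl
  ++-congˡ : ∀ (f f′ : Vector (Fin m) (suc a)) (g : Vector (Fin m) b) → f ≗ f′ → (f ++ g) ≗ (f′ ++ g)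
  ++-congˡ f f′ g f≗f′ i with splitAt (suc a) i
  ... | inj₁ j = f≗f′ j
  ... | inj₂ _ = refl

-- Spanning subgraphs, isomorphism and rigidity

IsHom-resp-≗ : (G : SimpleGraph n) (H : Graph m) {f g : Fin n → Fin m} → f ≗ g → IsHom G H f → IsHom G H g
IsHom-resp-≗ G H f≗g hom-f v w v~w = subst₂ (Adj H) (f≗g v) (f≗g w) (hom-f v w v~w)

homIndicator : SimpleGraph n → Graph m → (Fin n → Fin m) → ℕ
homIndicator G H f = indicator (isHom? G H f)

homIndicator-ext : (G : SimpleGraph n) (H : Graph m) → Extensional (homIndicator G H)
homIndicator-ext G H f g f≗g = indicator-cong (isHom? G H f) (isHom? G H g)
  (IsHom-resp-≗ G H f≗g) (IsHom-resp-≗ G H (sym ∘ f≗g))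

hom-∑ᶠ : (G : SimpleGraph n) (H : Graph m) → hom G H ≡ ∑ᶠ (homIndicator G H)
hom-∑ᶠ G H = countFin-∑ᶠ (isHom? G H)

-- A spanning subgraph up to relabelling. The orders `a` and `n` are separate indices because the
-- forest built below has `size ks` vertices, which equals the order of `G` only through the
-- bijection.
record Spanning (F : SimpleGraph a) (G : SimpleGraph n) : Set where
  field
    vertices : Fin a ↔ Fin n
    edges    : ∀ u v → Adj (graph F) u v → Adj (graph G) (Inverse.to vertices u) (Inverse.to vertices v)
  open Inverse vertices public

hom-spanning : {F : SimpleGraph a} {G : SimpleGraph n} (ι : Spanning F G) (H : Graph m) →
  hom G H ≡ ∑ᶠ λ f → homIndicator G H (f ∘ Spanning.from ι)
hom-spanning {G = G} ι H = trans (hom-∑ᶠ G H)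
  (∑ᶠ-permute (↔-sym (Spanning.vertices ι)) (homIndicator G H) (homIndicator-ext G H))

restrict-hom : {F : SimpleGraph a} {G : SimpleGraph n} (ι : Spanning F G) (H : Graph m) →
  ∀ f → IsHom G H (f ∘ Spanning.from ι) → IsHom F H f
restrict-hom ι H f hom-f u v u~v = subst₂ (Adj H)
  (cong f (strictlyInverseʳ u)) (cong f (strictlyInverseʳ v)) (hom-f (to u) (to v) (edges u v u~v))
  where open Spanning ι

hom-≤ : {F : SimpleGraph a} {G : SimpleGraph n} → Spanning F G → (H : Graph m) → hom G H ≤ hom F H
hom-≤ {F = F} {G} ι H = begin
  hom G H                                                    ≡⟨ hom-spanning ι H ⟩
  ∑ᶠ (λ f → homIndicator G H (f ∘ Spanning.from ι))
    ≤⟨ ∑ᶠ-mono-≤ (λ f → indicator-mono (isHom? G H _) (isHom? F H f) (restrict-hom ι H f)) ⟩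
  ∑ᶠ (homIndicator F H)                                ≡⟨ hom-∑ᶠ F H ⟨
  hom F H                                                    ∎
  where open ≤-Reasoning

-- A single homomorphism of `F` that breaks an edge of `G` makes the restriction bound strict.
hom-< : {F : SimpleGraph a} {G : SimpleGraph n} (ι : Spanning F G) (H : Graph m) →
  ∀ f → IsHom F H f → ¬ IsHom G H (f ∘ Spanning.from ι) → hom G H < hom F H
hom-< {F = F} {G} ι H f hom-f ¬hom-f = begin-strict
  hom G H                                                    ≡⟨ hom-spanning ι H ⟩
  ∑ᶠ (λ f → homIndicator G H (f ∘ Spanning.from ι))
    <⟨ ∑ᶠ-mono-< (λ f g f≗g → homIndicator-ext G H _ _ (f≗g ∘ from)) (homIndicator-ext F H)
         (λ f → indicator-mono (isHom? G H _) (isHom? F H f) (restrict-hom ι H f)) f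
         (indicator-< (isHom? G H _) (isHom? F H f) ¬hom-f hom-f) ⟩
  ∑ᶠ (homIndicator F H)                                ≡⟨ hom-∑ᶠ F H ⟨
  hom F H                                                    ∎
  where open ≤-Reasoning; open Spanning ι

≅-sym : {G : Graph a} {H : Graph b} → G ≅ H → H ≅ G
≅-sym {H = H} e = record
  { vertices = ↔-sym vertices
  ; adjacent = λ u v → mk⇔
      (λ u~v → Equivalence.from (adjacent (from u) (from v))
        (subst₂ (Adj H) (sym (strictlyInverseˡ u)) (sym (strictlyInverseˡ v)) u~v))
      (λ u~v → subst₂ (Adj H) (strictlyInverseˡ u) (strictlyInverseˡ v)
        (Equivalence.to (adjacent (from u) (from v)) u~v))
  }
  where open _≅_ e; open Inverse vertices

≅⇒Spanning : (F : SimpleGraph a) (G : SimpleGraph n) → graph F ≅ graph G → Spanning F G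
≅⇒Spanning F G e = record { vertices = vertices ; edges = λ u v → Equivalence.to (adjacent u v) }
  where open _≅_ e

Spanning-trans : {E : SimpleGraph a} {F : SimpleGraph b} {G : SimpleGraph n} →
  Spanning E F → Spanning F G → Spanning E G
Spanning-trans ι κ = record
  { vertices = Spanning.vertices κ ↔-∘ Spanning.vertices ι
  ; edges    = λ u v → Spanning.edges κ _ _ ∘ Spanning.edges ι u v
  }

hom-≅ : (F : SimpleGraph a) (G : SimpleGraph n) → graph F ≅ graph G → (H : Graph m) → hom F H ≡ hom G H
hom-≅ F G e H = ≤-antisym (hom-≤ (≅⇒Spanning G F (≅-sym e)) H) (hom-≤ (≅⇒Spanning F G e) H)

-- Every non-edge of `F` is separated by some homomorphism to `H`, so adding any edge to `F` lowers
-- the count.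
Rigid : SimpleGraph n → Graph m → Set
Rigid {n} {m} F H = ∀ u v → ¬ u ≡ v → ¬ Adj (graph F) u v →
  Σ[ f ∈ (Fin n → Fin m) ] IsHom F H f × ¬ Adj H (f u) (f v)

-- An edge of `G` outside `F` would destroy a homomorphism of `F`, and equal counts exclude this.
rigid-≅ : {F : SimpleGraph a} {G : SimpleGraph n} {H : Graph m} →
  Rigid F H → Spanning F G → hom G H ≡ hom F H → graph G ≅ graph F
rigid-≅ {F = F} {G} {H} rigid ι same = ≅-sym record
  { vertices = vertices
  ; adjacent = λ u v → mk⇔ (edges u v) (λ u~v → decidable-stable (adj? (graph F) u v) λ u≁v →
      let f , hom-f , fu≁fv = rigid u v (λ u≡v → loopless G (cong to u≡v) u~v) u≁v in
      <⇒≢ (hom-< ι H f hom-f λ hom-G → fu≁fv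
        (subst₂ (Adj H) (cong f (strictlyInverseʳ u)) (cong f (strictlyInverseʳ v)) (hom-G _ _ u~v))) same)
  }
  where open Spanning ι

-- Disjoint unions

infixr 5 _⊕_

_⊕_ : SimpleGraph a → SimpleGraph b → SimpleGraph (a + b)
_⊕_ {a} {b} G G′ = record
  { graph = record
    { Adj     = λ u v → Adj⊎ (splitAt a u) (splitAt a v)
    ; adj?    = λ u v → adj⊎? (splitAt a u) (splitAt a v)
    ; adj-sym = λ {u} {v} → adj⊎-sym (splitAt a u) (splitAt a v)
    }
  ; loopless = λ { {u} refl → irreflexive (splitAt a u) }
  }
  where
  Adj⊎ : Fin a ⊎ Fin b → Fin a ⊎ Fin b → Set
  Adj⊎ (inj₁ u) (inj₁ v) = Adj (graph G) u v
  Adj⊎ (inj₁ _) (inj₂ _) = ⊥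
  Adj⊎ (inj₂ _) (inj₁ _) = ⊥
  Adj⊎ (inj₂ u) (inj₂ v) = Adj (graph G′) u v
  adj⊎? : ∀ u v → Dec (Adj⊎ u v)
  adj⊎? (inj₁ u) (inj₁ v) = adj? (graph G) u v
  adj⊎? (inj₁ _) (inj₂ _) = no λ ()
  adj⊎? (inj₂ _) (inj₁ _) = no λ ()
  adj⊎? (inj₂ u) (inj₂ v) = adj? (graph G′) u v
  adj⊎-sym : ∀ u v → Adj⊎ u v → Adj⊎ v u
  adj⊎-sym (inj₁ _) (inj₁ _) = adj-sym (graph G)
  adj⊎-sym (inj₂ _) (inj₂ _) = adj-sym (graph G′)
  irreflexive : ∀ u → ¬ Adj⊎ u u
  irreflexive (inj₁ _) = loopless G refl
  irreflexive (inj₂ _) = loopless G′ refl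

module _ {G : SimpleGraph a} {G′ : SimpleGraph b} {H : Graph m} where

  ⊕-hom : (f : Fin a → Fin m) (g : Fin b → Fin m) → IsHom G H f → IsHom G′ H g → IsHom (G ⊕ G′) H (f ++ g)
  ⊕-hom f g hom-f hom-g u v u~v with splitAt a u | splitAt a v
  ... | inj₁ i | inj₁ j = hom-f i j u~v
  ... | inj₂ i | inj₂ j = hom-g i j u~v

  ⊕-homˡ : (f : Fin a → Fin m) (g : Fin b → Fin m) → IsHom (G ⊕ G′) H (f ++ g) → IsHom G H f
  ⊕-homˡ f g hom-fg u v u~v with hom-fg (u ↑ˡ b) (v ↑ˡ b)
  ... | hom-uv rewrite Fin.splitAt-↑ˡ a u b | Fin.splitAt-↑ˡ a v b = hom-uv u~v

  ⊕-homʳ : (f : Fin a → Fin m) (g : Fin b → Fin m) → IsHom (G ⊕ G′) H (f ++ g) → IsHom G′ H g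
  ⊕-homʳ f g hom-fg u v u~v with hom-fg (a ↑ʳ u) (a ↑ʳ v)
  ... | hom-uv rewrite Fin.splitAt-↑ʳ a b u | Fin.splitAt-↑ʳ a b v = hom-uv u~v

hom-⊕ : (G : SimpleGraph a) (G′ : SimpleGraph b) (H : Graph m) → hom (G ⊕ G′) H ≡ hom G H * hom G′ H
hom-⊕ {a} {b} {m} G G′ H = begin
  hom (G ⊕ G′) H                                               ≡⟨ hom-∑ᶠ (G ⊕ G′) H ⟩
  ∑ᶠ (homIndicator (G ⊕ G′) H)
    ≡⟨ ∑ᶠ-++ a (homIndicator (G ⊕ G′) H) (homIndicator-ext (G ⊕ G′) H) ⟩
  ∑ᶠ (λ f → ∑ᶠ λ g → homIndicator (G ⊕ G′) H (_++_ {m = a} {n = b} f g))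
    ≡⟨ ∑ᶠ-cong (λ f → trans (∑ᶠ-cong (split f)) (∑ᶠ-*ˡ (homIndicator G H f) (homIndicator G′ H))) ⟩
  ∑ᶠ (λ f → homIndicator G H f * ∑ᶠ (homIndicator G′ H))       ≡⟨ ∑ᶠ-*ʳ _ (homIndicator G H) ⟩
  ∑ᶠ (homIndicator G H) * ∑ᶠ (homIndicator G′ H)               ≡⟨ cong₂ _*_ (hom-∑ᶠ G H) (hom-∑ᶠ G′ H) ⟨
  hom G H * hom G′ H                                           ∎
  where
  open ≡-Reasoning
  split : (f : Fin a → Fin m) (g : Fin b → Fin m) →
    homIndicator (G ⊕ G′) H (f ++ g) ≡ homIndicator G H f * homIndicator G′ H g
  split f g = trans
    (indicator-cong (isHom? (G ⊕ G′) H (f ++ g)) (isHom? G H f ×-dec isHom? G′ H g)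
      (λ h → ⊕-homˡ {G = G} {G′} {H} f g h , ⊕-homʳ {G = G} {G′} {H} f g h)
      (λ (hom-f , hom-g) → ⊕-hom {G = G} {G′} {H} f g hom-f hom-g))
    (indicator-× (isHom? G H f) (isHom? G′ H g))

-- Homomorphisms of stars and matchings

powerSum : Graph m → ℕ → ℕ
powerSum {m} H p = ∑[ x < m ] (degree H x ^ p)

module _ (H : Graph m) where

  allNeighbours : Fin m → (Fin k → Fin m) → ℕ
  allNeighbours x f = indicator (Fin.all? λ i → adj? H x (f i))

  allNeighbours-ext : ∀ x → Extensional (allNeighbours {k} x)
  allNeighbours-ext x f g f≗g = indicator-cong (Fin.all? λ i → adj? H x (f i)) (Fin.all? λ i → adj? H x (g i))
    (λ h i → subst (Adj H x) (f≗g i) (h i)) (λ h i → subst (Adj H x) (sym (f≗g i)) (h i))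

  allNeighbours-◂ : ∀ x y (f : Fin k → Fin m) → allNeighbours x (y ◂ f) ≡ indicator (adj? H x y) * allNeighbours x f
  allNeighbours-◂ x y f = trans
    (indicator-cong (Fin.all? λ i → adj? H x ((y ◂ f) i)) (adj? H x y ×-dec Fin.all? λ i → adj? H x (f i))
      (λ h → h zero , h ∘ suc) λ { (h , _) zero → h ; (_ , h) (suc i) → h i })
    (indicator-× (adj? H x y) (Fin.all? λ i → adj? H x (f i)))

  ∑ᶠ-allNeighbours : ∀ k x → ∑ᶠ (allNeighbours {k} x) ≡ degree H x ^ k
  ∑ᶠ-allNeighbours zero    x = ∑ᶠ-zero (allNeighbours x) (λ ()) (allNeighbours-ext x)
  ∑ᶠ-allNeighbours (suc k) x = begin
    ∑ᶠ (allNeighbours {suc k} x)                            ≡⟨ ∑ᶠ-suc (allNeighbours x) (allNeighbours-ext x) ⟩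
    ∑[ y < m ] ∑ᶠ (λ f → allNeighbours {suc k} x (y ◂ f))
      ≡⟨ sum-cong-≗ (λ y → trans (∑ᶠ-cong (allNeighbours-◂ x y)) (∑ᶠ-*ˡ (indicator (adj? H x y)) (allNeighbours x))) ⟩
    ∑[ y < m ] (indicator (adj? H x y) * ∑ᶠ (allNeighbours {k} x))
      ≡⟨ *-distribʳ-sum (∑ᶠ (allNeighbours {k} x)) (λ y → indicator (adj? H x y)) ⟨
    sum (λ y → indicator (adj? H x y)) * ∑ᶠ (allNeighbours {k} x)
      ≡⟨ cong₂ _*_ (sym (countFin-sum (adj? H x))) (∑ᶠ-allNeighbours k x) ⟩
    degree H x ^ suc k                                      ∎
    where open ≡-Reasoning

  -- Once the centre is sent to `x`, the leaves choose neighbours of `x` independently.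
  hom-star : ∀ k → hom K[ 1 , k ] H ≡ powerSum H k
  hom-star k = begin
    hom K[ 1 , k ] H                                            ≡⟨ hom-∑ᶠ K[ 1 , k ] H ⟩
    ∑ᶠ (homIndicator K[ 1 , k ] H)
      ≡⟨ ∑ᶠ-suc (homIndicator K[ 1 , k ] H) (homIndicator-ext K[ 1 , k ] H) ⟩
    ∑[ x < m ] ∑ᶠ (λ f → homIndicator K[ 1 , k ] H (x ◂ f))
      ≡⟨ sum-cong-≗ (λ x → trans (∑ᶠ-cong (leaves x)) (∑ᶠ-allNeighbours k x)) ⟩
    powerSum H k                                                ∎
    where
    open ≡-Reasoning
    leaves : ∀ x (f : Fin k → Fin m) → homIndicator K[ 1 , k ] H (x ◂ f) ≡ allNeighbours x f
    leaves x f = indicator-cong (isHom? K[ 1 , k ] H (x ◂ f)) (Fin.all? λ i → adj? H x (f i))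
      (λ h i → h zero (suc i) _)
      λ { h zero (suc j) _ → h j ; h (suc i) zero _ → adj-sym H (h i) }

K₂≅K₁₁ : graph (K 2) ≅ graph K[ 1 , 1 ]
K₂≅K₁₁ = record
  { vertices = ↔-id _
  ; adjacent = λ
    { zero zero → mk⇔ (λ h → h refl) λ ()
    ; zero (suc zero) → mk⇔ _ λ _ ()
    ; (suc zero) zero → mk⇔ _ λ _ ()
    ; (suc zero) (suc zero) → mk⇔ (λ h → h refl) λ ()
    }
  }

hom-K₂ : (H : Graph m) → hom (K 2) H ≡ powerSum H 1
hom-K₂ H = trans (hom-≅ (K 2) K[ 1 , 1 ] K₂≅K₁₁ H) (hom-star H 1)

-- The identity on vertices suffices: `quotient` and `remainder` are computed by splitting off the
-- first block of `n` vertices.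
copies-suc : ∀ k (G : SimpleGraph n) → graph (copies (suc k) G) ≅ graph (G ⊕ copies k G)
copies-suc {n} k G = record { vertices = ↔-id _ ; adjacent = adjacent }
  where
  adjacent : ∀ u v → Adj (graph (copies (suc k) G)) u v ⇔ Adj (graph (G ⊕ copies k G)) u v
  adjacent u v with splitAt n u | splitAt n v
  ... | inj₁ _ | inj₁ _ = mk⇔ proj₂ (refl ,_)
  ... | inj₁ _ | inj₂ _ = mk⇔ (λ ()) λ ()
  ... | inj₂ _ | inj₁ _ = mk⇔ (λ ()) λ ()
  ... | inj₂ _ | inj₂ _ = mk⇔ (λ (p , q) → Fin.suc-injective p , q) λ (p , q) → cong suc p , q

hom-copies : ∀ k (G : SimpleGraph n) (H : Graph m) → hom (copies k G) H ≡ hom G H ^ k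
hom-copies zero    G H = refl
hom-copies (suc k) G H = begin
  hom (copies (suc k) G) H     ≡⟨ hom-≅ (copies (suc k) G) (G ⊕ copies k G) (copies-suc k G) H ⟩
  hom (G ⊕ copies k G) H       ≡⟨ hom-⊕ G (copies k G) H ⟩
  hom G H * hom (copies k G) H ≡⟨ cong (hom G H *_) (hom-copies k G H) ⟩
  hom G H ^ suc k              ∎
  where open ≡-Reasoning

-- Spanning star forests

size : List ℕ → ℕ
size []       = 0
size (k ∷ ks) = 2 + k + size ks

-- The parts are the stars K_{1,k+1}, so that every part has an edge.
forest : (ks : List ℕ) → SimpleGraph (size ks)
forest []       = K 0
forest (k ∷ ks) = K[ 1 , suc k ] ⊕ forest ks

starHoms : Graph m → List ℕ → ℕ
starHoms H ks = product (List.map (λ k → powerSum H (suc k)) ks)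

hom-forest : (ks : List ℕ) (H : Graph m) → hom (forest ks) H ≡ starHoms H ks
hom-forest []       H = refl
hom-forest (k ∷ ks) H = trans (hom-⊕ K[ 1 , suc k ] (forest ks) H)
  (cong₂ _*_ (hom-star H (suc k)) (hom-forest ks H))

unique-++⁻ : (xs : List A) {ys : List A} → Unique (xs List.++ ys) →
  Unique xs × Unique ys × (∀ {x} → x ∈ xs → x ∉ ys)
unique-++⁻ []       ys!          = [] , ys! , λ ()
unique-++⁻ (x ∷ xs) (x∉ ∷ xsys!) =
  let xs! , ys! , disjoint = unique-++⁻ xs xsys! in
  All.++⁻ˡ xs x∉ ∷ xs! , ys! ,
  λ { (here refl) x∈ys → All.lookup (All.++⁻ʳ xs x∉) x∈ys refl ; (there x∈xs) → disjoint x∈xs }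

lookup-injective : {xs : List A} → Unique xs → ∀ {i j} → lookup xs i ≡ lookup xs j → i ≡ j
lookup-injective         (_  ∷ _)   {zero}  {zero}  _  = refl
lookup-injective {xs = _ ∷ xs} (x∉ ∷ _)   {zero}  {suc j} eq = contradiction eq (All.lookup x∉ (∈-lookup j))
lookup-injective {xs = _ ∷ xs} (x∉ ∷ _)   {suc i} {zero}  eq = contradiction (sym eq) (All.lookup x∉ (∈-lookup i))
lookup-injective         (_  ∷ xs!) {suc i} {suc j} eq = cong suc (lookup-injective xs! eq)

module _ (G : SimpleGraph n) where

  -- One leaf is kept apart from the rest, so a star always has an edge; the length of `rest` is its
  -- entry in the list that defines `forest`.
  record Star : Set where
    constructor star
    field
      centre      : Fin n
      first       : Fin n
      rest        : List (Fin n)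
      centre-adj  : All (Adj (graph G) centre) (first ∷ rest)

    starVertices : List (Fin n)
    starVertices = centre ∷ first ∷ rest

  open Star

  covered : List Star → List (Fin n)
  covered []       = []
  covered (s ∷ ss) = starVertices s List.++ covered ss

  -- If `w` is a centre, `v` becomes its leaf. If `w` is a leaf, its star either is recentred at `w`
  -- or gives `w` up to form a new edge with `v`; it gives `w` up only if another leaf remains.
  attach : ∀ ss {v w} → Adj (graph G) v w → w ∈ covered ss → ∃[ ss′ ] covered ss′ ↭ v ∷ covered ss
  attach (star c x xs c~ ∷ ss) {v} {w} v~w w∈ with ∈-++⁻ (c ∷ x ∷ xs) w∈
  ... | inj₂ w∈ss =
    let ss′ , ss′↭ = attach ss v~w w∈ss in
    star c x xs c~ ∷ ss′ , ↭-trans (++⁺ˡ (c ∷ x ∷ xs) ss′↭) (shift v (c ∷ x ∷ xs) (covered ss))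
  ... | inj₁ (here refl) =
    star c v (x ∷ xs) (adj-sym (graph G) v~w ∷ c~) ∷ ss , ↭-swap c v ↭-refl
  ... | inj₁ (there w∈xs) with ∈-∃++ w∈xs
  -- The star is the single edge from `c` to `w`: recentre it at `w`, with leaves `v` and `c`.
  ... | [] , [] , refl = star w v (c ∷ []) (adj-sym (graph G) v~w ∷ adj-sym (graph G) (All.head c~) ∷ []) ∷ ss ,
    ↭-trans (↭-swap w v ↭-refl) (↭-prep v (↭-swap w c ↭-refl))
  -- Here `w` is the distinguished leaf, and `y` takes over that role.
  ... | [] , y ∷ ys , refl = star w v [] (adj-sym (graph G) v~w ∷ []) ∷ star c y ys (All.tail c~) ∷ ss ,
    ↭-trans (↭-swap w v ↭-refl) (↭-prep v (↭-swap w c ↭-refl))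
  ... | x ∷ xs , ys , refl = star w v [] (adj-sym (graph G) v~w ∷ []) ∷ star c x (xs List.++ ys) c~′ ∷ ss ,
    ↭-trans (↭-swap w v ↭-refl) (↭-prep v (↭-sym
      (++⁺ʳ (covered ss) (shift w (c ∷ x ∷ xs) ys))))
    where
    c~′ : All (Adj (graph G) c) (x ∷ xs List.++ ys)
    c~′ = All.++⁺ (All.++⁻ˡ (x ∷ xs) c~) (All.tail (All.++⁻ʳ (x ∷ xs) c~))

  module _ (neighbour : ∀ v → ∃[ w ] Adj (graph G) v w) where

    open DecMembership (Fin._≟_ {n}) using (_∈?_)

    unique-extend : ∀ {vs ws v} → v ∉ vs → Unique vs → ws ↭ v ∷ vs → Unique ws
    unique-extend {vs} v∉ vs! ws↭ = Permutationₛ.Unique-resp-↭ (setoid (Fin n)) (↭⇒↭ₛ (↭-sym ws↭))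
      (All.tabulate (λ u∈vs v≡u → v∉ (subst (_∈ vs) (sym v≡u) u∈vs)) ∷ vs!)

    -- An uncovered vertex is attached through a covered neighbour; if its chosen neighbour is
    -- uncovered as well, the two start a new star.
    cover : ∀ vs → ∃[ ss ] Unique (covered ss) × (∀ {v} → v ∈ vs → v ∈ covered ss)
    cover []       = [] , [] , λ ()
    cover (v ∷ vs) with cover vs
    ... | ss , ss! , vs⊆ with v ∈? covered ss
    ...   | yes v∈ = ss , ss! , λ { (here refl) → v∈ ; (there u∈) → vs⊆ u∈ }
    ...   | no  v∉ with neighbour v
    ...     | w , v~w with w ∈? covered ss
    ...       | yes w∈ =
      let ss′ , ss′↭ = attach ss v~w w∈ in
      ss′ , unique-extend v∉ ss! ss′↭ ,
      λ { (here refl) → ∈-resp-↭ (↭-sym ss′↭) (here refl) ; (there u∈) → ∈-resp-↭ (↭-sym ss′↭) (there (vs⊆ u∈)) }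
    ...       | no  w∉ = star v w [] (v~w ∷ []) ∷ ss ,
      unique-extend (λ { (here v≡w) → loopless G v≡w v~w ; (there v∈) → v∉ v∈ })
        (unique-extend w∉ ss! ↭-refl) ↭-refl ,
      λ { (here refl) → here refl ; (there u∈) → there (there (vs⊆ u∈)) }

  parts : List Star → List ℕ
  parts = List.map (length ∘ rest)

  place : (ss : List Star) → Fin (size (parts ss)) → Fin n
  place (s ∷ ss) i = [ lookup (starVertices s) , place ss ]′ (splitAt (length (starVertices s)) i)

  place-∈ : ∀ ss i → place ss i ∈ covered ss
  place-∈ (s ∷ ss) i with splitAt (length (starVertices s)) i
  ... | inj₁ j = ∈-++⁺ˡ (∈-lookup {xs = starVertices s} j)
  ... | inj₂ j = ∈-++⁺ʳ (starVertices s) (place-∈ ss j)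

  place-injective : ∀ ss → Unique (covered ss) → ∀ {i j} → place ss i ≡ place ss j → i ≡ j
  place-injective (s ∷ ss) ss! {i} {j} eq = begin
    i                             ≡⟨ Fin.join-splitAt ℓ r i ⟨
    join ℓ r (splitAt ℓ i)        ≡⟨ cong (join ℓ r) (same (splitAt ℓ i) (splitAt ℓ j) eq) ⟩
    join ℓ r (splitAt ℓ j)        ≡⟨ Fin.join-splitAt ℓ r j ⟩
    j                             ∎
    where
    open ≡-Reasoning
    ℓ = length (starVertices s)
    r = size (parts ss)
    uniqueness = unique-++⁻ (starVertices s) ss!
    disjoint : ∀ {x} → x ∈ starVertices s → x ∉ covered ss
    disjoint = proj₂ (proj₂ uniqueness)
    same : ∀ x y → [ lookup (starVertices s) , place ss ]′ x ≡ [ lookup (starVertices s) , place ss ]′ y → x ≡ y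
    same (inj₁ x) (inj₁ y) eq = cong inj₁ (lookup-injective (proj₁ uniqueness) eq)
    same (inj₁ x) (inj₂ y) eq = contradiction (subst (_∈ covered ss) (sym eq) (place-∈ ss y)) (disjoint (∈-lookup x))
    same (inj₂ x) (inj₁ y) eq = contradiction (subst (_∈ covered ss) eq (place-∈ ss x)) (disjoint (∈-lookup y))
    same (inj₂ x) (inj₂ y) eq = cong inj₂ (place-injective ss (proj₁ (proj₂ uniqueness)) eq)

  place-surjective : ∀ ss {v} → v ∈ covered ss → ∃[ i ] place ss i ≡ v
  place-surjective (s ∷ ss) v∈ with ∈-++⁻ (starVertices s) v∈
  ... | inj₁ v∈s = join ℓ r (inj₁ (Any.index v∈s)) ,
    trans (cong [ lookup (starVertices s) , place ss ]′ (Fin.splitAt-join ℓ r (inj₁ (Any.index v∈s)))) (sym (lookup-index v∈s))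
    where ℓ = length (starVertices s); r = size (parts ss)
  ... | inj₂ v∈ss = let i , eq = place-surjective ss v∈ss in join ℓ r (inj₂ i) ,
    trans (cong [ lookup (starVertices s) , place ss ]′ (Fin.splitAt-join ℓ r (inj₂ i))) eq
    where ℓ = length (starVertices s); r = size (parts ss)

  place-edge : ∀ ss i j → Adj (graph (forest (parts ss))) i j → Adj (graph G) (place ss i) (place ss j)
  place-edge (s ∷ ss) i j i~j with splitAt (length (starVertices s)) i | splitAt (length (starVertices s)) j
  ... | inj₁ zero    | inj₁ (suc y) = All.lookup (centre-adj s) (∈-lookup y)
  ... | inj₁ (suc x) | inj₁ zero    = adj-sym (graph G) (All.lookup (centre-adj s) (∈-lookup x))
  ... | inj₂ x       | inj₂ y       = place-edge ss x y i~j

  spanningForest : (∀ v → ∃[ w ] Adj (graph G) v w) → ∃[ ks ] Spanning (forest ks) G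
  spanningForest neighbour =
    let ss , ss! , total = cover neighbour (allFin n) in
    parts ss , record
      { vertices = ⤖⇒↔ (mk⤖ (place-injective ss ss! , λ v →
          let i , eq = place-surjective ss (total (∈-allFin v)) in i , λ { refl → eq }))
      ; edges = place-edge ss
      }

-- Power sums and star products

rearrange-+ : ∀ a c e f → a * (c + f) + (a + e) * c + e * f ≡ a * c + (a + e) * (c + f)
rearrange-+ = solve-∀

-- With `b = a + e` and `d = c + f` the two sides differ by `e * f`.
rearrangement-≤ : ∀ {a b c d} → a ≤ b → c ≤ d → a * d + b * c ≤ a * c + b * d
rearrangement-≤ {a} {b} {c} {d} a≤b c≤d with m≤n⇒∃[o]m+o≡n a≤b | m≤n⇒∃[o]m+o≡n c≤d
... | e , refl | f , refl = ≤-trans (m≤m+n _ (e * f)) (≤-reflexive (rearrange-+ a c e f))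

rearrangement-< : ∀ {a b c d} → a < b → c < d → a * d + b * c < a * c + b * d
rearrangement-< {a} {b} {c} {d} a<b c<d with m≤n⇒∃[o]m+o≡n (<⇒≤ a<b) | m≤n⇒∃[o]m+o≡n (<⇒≤ c<d)
... | zero  , refl | _            = contradiction a<b (<-irrefl (sym (+-identityʳ a)))
... | suc _ , refl | zero  , refl = contradiction c<d (<-irrefl (sym (+-identityʳ c)))
... | suc e , refl | suc f , refl = <-≤-trans (m<m+n _ z<s) (≤-reflexive (rearrange-+ a c (suc e) (suc f)))

sum-*-sum : (f : Fin m → ℕ) (g : Fin n → ℕ) → sum f * sum g ≡ ∑[ i < m ] ∑[ j < n ] (f i * g j)
sum-*-sum f g = trans (*-distribʳ-sum (sum g) f) (sum-cong-≗ λ i → *-distribˡ-sum (f i) g)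

module PowerSums {m} (d : Fin m → ℕ) where

  σ : ℕ → ℕ
  σ p = ∑[ i < m ] (d i ^ p)

  private
    mixed : ℕ → ℕ → ℕ → ℕ → ℕ
    mixed p q x y = x ^ p * y ^ q + y ^ p * x ^ q

    -- Doubling symmetrizes the product over pairs `(i , j)`, so that products of power sums can be
    -- compared pair by pair.
    mixed-sum : ∀ p q → 2 * (σ p * σ q) ≡ ∑[ i < m ] ∑[ j < m ] mixed p q (d i) (d j)
    mixed-sum p q = begin
      2 * (σ p * σ q)                        ≡⟨ cong ((σ p * σ q) +_) (+-identityʳ _) ⟩
      σ p * σ q + σ p * σ q
        ≡⟨ cong₂ _+_ (sum-*-sum (λ i → d i ^ p) (λ j → d j ^ q))
             (trans (sum-*-sum (λ i → d i ^ p) (λ j → d j ^ q)) (∑-comm λ i j → d i ^ p * d j ^ q)) ⟩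
      (∑[ i < m ] ∑[ j < m ] (d i ^ p * d j ^ q)) + (∑[ i < m ] ∑[ j < m ] (d j ^ p * d i ^ q))
        ≡⟨ ∑-distrib-+ (λ i → ∑[ j < m ] (d i ^ p * d j ^ q)) (λ i → ∑[ j < m ] (d j ^ p * d i ^ q)) ⟨
      (∑[ i < m ] (∑[ j < m ] (d i ^ p * d j ^ q) + ∑[ j < m ] (d j ^ p * d i ^ q)))
        ≡⟨ sum-cong-≗ (λ i → ∑-distrib-+ (λ j → d i ^ p * d j ^ q) (λ j → d j ^ p * d i ^ q)) ⟨
      (∑[ i < m ] ∑[ j < m ] mixed p q (d i) (d j)) ∎
      where open ≡-Reasoning

    factor : ∀ a b c e f g → (a * c) * (b * f) + (b * e) * (a * g) ≡ (a * b) * (c * f + e * g)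
    factor = solve-∀

    factor′ : ∀ a b c e f g → a * (b * (e * f)) + b * (a * (c * g)) ≡ (a * b) * (c * g + e * f)
    factor′ = solve-∀

    inner : ∀ p r s x y → mixed (p + r) (p + s) x y ≡ (x ^ p * y ^ p) * mixed r s x y
    inner p r s x y
      rewrite ^-distribˡ-+-* x p r | ^-distribˡ-+-* y p r | ^-distribˡ-+-* x p s | ^-distribˡ-+-* y p s =
      factor (x ^ p) (y ^ p) (x ^ r) (y ^ r) (y ^ s) (x ^ s)

    outer : ∀ p r s x y → mixed p (p + (r + s)) x y ≡ (x ^ p * y ^ p) * (x ^ r * x ^ s + y ^ r * y ^ s)
    outer p r s x y
      rewrite ^-distribˡ-+-* x p (r + s) | ^-distribˡ-+-* y p (r + s)
            | ^-distribˡ-+-* x r s | ^-distribˡ-+-* y r s =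
      factor′ (x ^ p) (y ^ p) (x ^ r) (y ^ r) (y ^ s) (x ^ s)

    spread-≤ : ∀ r s x y → mixed r s x y ≤ x ^ r * x ^ s + y ^ r * y ^ s
    spread-≤ r s x y with ≤-total x y
    ... | inj₁ x≤y = rearrangement-≤ (^-monoˡ-≤ r x≤y) (^-monoˡ-≤ s x≤y)
    ... | inj₂ y≤x = subst₂ _≤_ (+-comm (y ^ r * x ^ s) (x ^ r * y ^ s)) (+-comm (y ^ r * y ^ s) (x ^ r * x ^ s))
      (rearrangement-≤ (^-monoˡ-≤ r y≤x) (^-monoˡ-≤ s y≤x))

    mixed-≤ : ∀ p r s x y → mixed (p + r) (p + s) x y ≤ mixed p (p + (r + s)) x y
    mixed-≤ p r s x y = subst₂ _≤_ (sym (inner p r s x y)) (sym (outer p r s x y))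
      (*-monoʳ-≤ (x ^ p * y ^ p) (spread-≤ r s x y))

  -- Log-convexity. For a pair of values `x`, `y` the outer term exceeds the inner one by x^p y^p
  -- (x^r - y^r)(x^s - y^s), whose last two factors never have opposite signs.
  σ-spread : ∀ p r s → σ (p + r) * σ (p + s) ≤ σ p * σ (p + (r + s))
  σ-spread p r s = *-cancelˡ-≤ 2 (subst₂ _≤_ (sym (mixed-sum (p + r) (p + s))) (sym (mixed-sum p (p + (r + s))))
    (sum-mono-≤ λ i → sum-mono-≤ λ j → mixed-≤ p r s (d i) (d j)))

  -- One pair of distinct values already gives a strict term; positivity keeps its common factor x^p
  -- y^p nonzero.
  σ-spread-< : (∀ i → 0 < d i) → ∀ i j → d i < d j → ∀ p → σ (p + 1) * σ (p + 1) < σ p * σ (p + 2)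
  σ-spread-< d>0 i j di<dj p =
    *-cancelˡ-< 2 _ _ (subst₂ _<_ (sym (mixed-sum (p + 1) (p + 1))) (sym (mixed-sum p (p + 2)))
      (sum-mono-< (λ i → sum-mono-≤ λ j → mixed-≤ p 1 1 (d i) (d j)) i
        (sum-mono-< (λ j → mixed-≤ p 1 1 (d i) (d j)) j
          (subst₂ _<_ (sym (inner p 1 1 (d i) (d j))) (sym (outer p 1 1 (d i) (d j)))
            (*-monoʳ-< (d i ^ p * d j ^ p) {{factor>0}}
              (rearrangement-< (^-monoˡ-< 1 di<dj) (^-monoˡ-< 1 di<dj)))))))
    where
    factor>0 : NonZero (d i ^ p * d j ^ p)
    factor>0 = m*n≢0 (d i ^ p) (d j ^ p)
      {{m^n≢0 (d i) p {{>-nonZero (d>0 i)}}}} {{m^n≢0 (d j) p {{>-nonZero (d>0 j)}}}}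

square-* : ∀ x y → (x * y) ^ 2 ≡ x ^ 2 * y ^ 2
square-* = unfolded
  where
  unfolded : ∀ x y → x * y * (x * y * 1) ≡ x * (x * 1) * (y * (y * 1))
  unfolded = solve-∀

^2-cancel-< : ∀ {x y} → x ^ 2 < y ^ 2 → x < y
^2-cancel-< x²<y² = ≰⇒> λ y≤x → <⇒≱ x²<y² (^-monoˡ-≤ 2 y≤x)

*-mono-≤-eq : ∀ {x y X Y} → 0 < X → 0 < Y → x ≤ X → y ≤ Y → x * y ≡ X * Y → x ≡ X × y ≡ Y
*-mono-≤-eq {x} {y} {X} {Y} X>0 Y>0 x≤X y≤Y xy≡XY with m≤n⇒m<n∨m≡n x≤X
... | inj₁ x<X = contradiction xy≡XY (<⇒≢ (≤-<-trans (*-monoʳ-≤ x y≤Y) (*-monoˡ-< Y {{>-nonZero Y>0}} x<X)))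
... | inj₂ refl = refl , *-cancelˡ-≡ y Y x {{>-nonZero X>0}} xy≡XY

-- The sequence σ stands for the power sums of the degrees of H, so that the
-- star on 2 + k vertices has σ (1 + k) homomorphisms and the edge has σ 1.
module StarProducts (σ : ℕ → ℕ) (σ>0 : ∀ p → 0 < σ p)
  (spread : ∀ p r s → σ (p + r) * σ (p + s) ≤ σ p * σ (p + (r + s))) where

  S : ℕ
  S = σ 1

  starProduct : List ℕ → ℕ
  starProduct ks = product (List.map (λ k → σ (suc k)) ks)

  instance
    σ≢0 : ∀ {p} → NonZero (σ p)
    σ≢0 {p} = >-nonZero (σ>0 p)

  S^>0 : ∀ n → 0 < S ^ n
  S^>0 n = m^n>0 S n

  -- Squaring turns the bound by S^(n/2) into one with integer exponents, to which a star on `2 + k`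
  -- vertices contributes the factor `S ^ (2 + k)`.
  starProduct²-≤ : ∀ ks → All (λ k → σ (suc k) ^ 2 ≤ S ^ (2 + k)) ks →
    starProduct ks ^ 2 ≤ S ^ size ks
  starProduct²-≤ []       []         = ≤-refl
  starProduct²-≤ (k ∷ ks) (k≤ ∷ ks≤) = begin
    (σ (suc k) * starProduct ks) ^ 2   ≡⟨ square-* (σ (suc k)) (starProduct ks) ⟩
    σ (suc k) ^ 2 * starProduct ks ^ 2 ≤⟨ *-mono-≤ k≤ (starProduct²-≤ ks ks≤) ⟩
    S ^ (2 + k) * S ^ size ks          ≡⟨ ^-distribˡ-+-* S (2 + k) (size ks) ⟨
    S ^ size (k ∷ ks)                  ∎
    where open ≤-Reasoning

  -- All bounds are positive, so equality of the products forces equality in every factor.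
  starProduct²-≡ : ∀ ks → All (λ k → σ (suc k) ^ 2 ≤ S ^ (2 + k)) ks →
    starProduct ks ^ 2 ≡ S ^ size ks → All (λ k → σ (suc k) ^ 2 ≡ S ^ (2 + k)) ks
  starProduct²-≡ []       []         _  = []
  starProduct²-≡ (k ∷ ks) (k≤ ∷ ks≤) eq =
    let k≡ , ks≡ = *-mono-≤-eq (S^>0 (2 + k)) (S^>0 (size ks)) k≤ (starProduct²-≤ ks ks≤)
          (trans (sym (square-* (σ (suc k)) (starProduct ks)))
            (trans eq (^-distribˡ-+-* S (2 + k) (size ks))))
    in k≡ ∷ starProduct²-≡ ks ks≤ ks≡

  -- Here n₀ is `3 + t`: the star on `3 + t` vertices beats the edges, and no star on `2 + k`
  -- vertices with `k ≤ t` does.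
  module Threshold (t : ℕ) (beats : S ^ (3 + t) < σ (2 + t) ^ 2)
    (below : ∀ k → k < 1 + t → σ (suc k) ^ 2 ≤ S ^ (2 + k)) where

    open ≤-Reasoning

    -- By log-convexity the ratio of consecutive power sums never decreases, so once its square
    -- exceeds `S` it continues to do so.
    growth-step : ∀ j → S * σ (1 + j) ^ 2 < σ (2 + j) ^ 2 → S * σ (2 + j) ^ 2 < σ (3 + j) ^ 2
    growth-step j grows = *-cancelˡ-< (σ₁ ^ 2) _ _ (begin-strict
      σ₁ ^ 2 * (S * σ₂ ^ 2)     ≡⟨ regroup (σ₁ ^ 2) S (σ₂ ^ 2) ⟩
      S * σ₁ ^ 2 * σ₂ ^ 2       <⟨ *-monoˡ-< (σ₂ ^ 2) {{m^n≢0 σ₂ 2}} grows ⟩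
      σ₂ ^ 2 * σ₂ ^ 2           ≡⟨ square-* σ₂ σ₂ ⟨
      (σ₂ * σ₂) ^ 2             ≤⟨ ^-monoˡ-≤ 2 log-convex ⟩
      (σ₁ * σ₃) ^ 2             ≡⟨ square-* σ₁ σ₃ ⟩
      σ₁ ^ 2 * σ₃ ^ 2           ∎)
      where
      σ₁ = σ (1 + j)
      σ₂ = σ (2 + j)
      σ₃ = σ (3 + j)
      regroup : ∀ a b c → a * (b * c) ≡ b * a * c
      regroup = solve-∀
      log-convex : σ₂ * σ₂ ≤ σ₁ * σ₃
      log-convex = subst₂ (λ p q → σ p * σ p ≤ σ₁ * σ q) (+-comm (1 + j) 1) (+-comm (1 + j) 2) (spread (1 + j) 1 1)

    -- In terms of f(a) = σ(a - 1) / S^(a/2) this is f(2 + j) < f(3 + j): the increase starts at a =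
    -- n₀ - 1, where f is at most 1 while f(n₀) exceeds 1.
    growth : ∀ {j} → t ≤ j → S * σ (1 + j) ^ 2 < σ (2 + j) ^ 2
    growth = go ∘ ≤⇒≤′
      where
      go : ∀ {j} → t ≤′ j → S * σ (1 + j) ^ 2 < σ (2 + j) ^ 2
      go ≤′-refl         = ≤-<-trans (*-monoʳ-≤ S (below t ≤-refl)) beats
      go (≤′-step {j} t≤j) = growth-step j (go t≤j)

    beats-above : ∀ {j} → t ≤ j → S ^ (3 + j) < σ (2 + j) ^ 2
    beats-above = go ∘ ≤⇒≤′
      where
      go : ∀ {j} → t ≤′ j → S ^ (3 + j) < σ (2 + j) ^ 2
      go ≤′-refl         = beats
      go (≤′-step {j} t≤j) = ≤-<-trans (*-monoʳ-≤ S (<⇒≤ (go t≤j))) (growth (m≤n⇒m≤1+n (≤′⇒≤ t≤j)))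

    -- Iterated `growth`: a star with at least n₀ - 1 vertices gains more from each further vertex
    -- than the factor S^(1/2) of a vertex in a matching.
    absorb-< : ∀ {j} → t ≤ j → ∀ N → S ^ suc N * σ (1 + j) ^ 2 < σ (1 + j + suc N) ^ 2
    absorb-< {j} t≤j zero = subst₂ (λ x p → x * σ (1 + j) ^ 2 < σ p ^ 2) (sym (*-identityʳ S)) (+-comm 1 (1 + j)) (growth t≤j)
    absorb-< {j} t≤j (suc N) = begin-strict
      S * S ^ suc N * σ (1 + j) ^ 2     ≡⟨ *-assoc S (S ^ suc N) _ ⟩
      S * (S ^ suc N * σ (1 + j) ^ 2)   ≤⟨ *-monoʳ-≤ S (<⇒≤ (absorb-< t≤j N)) ⟩
      S * σ (1 + (j + suc N)) ^ 2       <⟨ growth (m≤n⇒m≤n+o (suc N) t≤j) ⟩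
      σ (2 + (j + suc N)) ^ 2           ≡⟨ cong (λ i → σ (1 + i) ^ 2) (+-suc j (suc N)) ⟨
      σ (1 + j + suc (suc N)) ^ 2       ∎

    two-step : ∀ {j} → t ≤ j → S * σ (1 + j) < σ (3 + j)
    two-step {j} t≤j = ^2-cancel-< (begin-strict
      (S * σ (1 + j)) ^ 2         ≡⟨ regroup S (σ (1 + j)) ⟩
      S * (S * σ (1 + j) ^ 2)     ≤⟨ *-monoʳ-≤ S (<⇒≤ (growth t≤j)) ⟩
      S * σ (2 + j) ^ 2           <⟨ growth (m≤n⇒m≤1+n t≤j) ⟩
      σ (3 + j) ^ 2               ∎)
      where
      regroup : ∀ a b → (a * b) ^ 2 ≡ a * (a * b ^ 2)
      regroup a b = trans (square-* a b) (trans (cong (_* b ^ 2) (cong (a *_) (*-identityʳ a))) (*-assoc a a _))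

    -- Two growth steps beat one factor `S`; log-convexity then moves the two exponents apart to 1
    -- and `1 + k + (2 + j)`, which is a merged star next to an edge.
    merge-< : ∀ k {j} → t ≤ j → σ (1 + k) * σ (1 + j) < σ (1 + k + (2 + j))
    merge-< k {j} t≤j = *-cancelˡ-< S _ _ (begin-strict
      S * (σ (1 + k) * σ (1 + j))   ≡⟨ regroup S (σ (1 + k)) (σ (1 + j)) ⟩
      σ (1 + k) * (S * σ (1 + j))   <⟨ *-monoʳ-< (σ (1 + k)) (two-step t≤j) ⟩
      σ (1 + k) * σ (3 + j)         ≤⟨ spread 1 k (2 + j) ⟩
      S * σ (1 + k + (2 + j))       ∎)
      where
      regroup : ∀ a b c → a * (b * c) ≡ b * (a * c)
      regroup = solve-∀

    small-parts : ∀ ks → size ks < 3 + t → All (λ k → σ (suc k) ^ 2 ≤ S ^ (2 + k)) ks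
    small-parts []       _  = []
    small-parts (k ∷ ks) lt =
      below k (s<s⁻¹ (s<s⁻¹ (≤-<-trans (m≤m+n (2 + k) (size ks)) lt))) ∷
      small-parts ks (≤-<-trans (m≤n+m (size ks) (2 + k)) lt)

    -- Three cases. If the rest has at least n₀ vertices, it is first replaced by one star and then
    -- merged. Otherwise the rest is bounded by a power of `S`: if the new star is below the
    -- threshold, so is the whole product, and the full star beats that bound; if not, the new star
    -- absorbs the rest.
    add-star-< : ∀ k k′ ks → (3 + t ≤ size (k′ ∷ ks) → starProduct (k′ ∷ ks) ≤ σ (1 + k′ + size ks)) →
      3 + t ≤ size (k ∷ k′ ∷ ks) → starProduct (k ∷ k′ ∷ ks) < σ (1 + k + size (k′ ∷ ks))
    add-star-< k k′ ks rest-≤ large with 3 + t ≤? size (k′ ∷ ks)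
    ... | yes N≥ = ≤-<-trans (*-monoʳ-≤ (σ (suc k)) (rest-≤ N≥))
      (merge-< k (≤-trans (n≤1+n t) (s≤s⁻¹ (s≤s⁻¹ N≥))))
    ... | no N≱ with k <? 1 + t
    ...   | yes k< = ^2-cancel-< (begin-strict
      starProduct (k ∷ k′ ∷ ks) ^ 2   ≤⟨ starProduct²-≤ (k ∷ k′ ∷ ks) (below k k< ∷ small-parts (k′ ∷ ks) (≰⇒> N≱)) ⟩
      S ^ (2 + k + size (k′ ∷ ks))              ≡⟨ cong (S ^_) (+-suc (2 + k) (suc (k′ + size ks))) ⟩
      S ^ (3 + (k + suc (k′ + size ks)))
        <⟨ beats-above (s≤s⁻¹ (s≤s⁻¹ (s≤s⁻¹ (subst (3 + t ≤_) (+-suc (2 + k) (suc (k′ + size ks))) large)))) ⟩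
      σ (2 + (k + suc (k′ + size ks))) ^ 2  ≡⟨ cong (λ i → σ (1 + i) ^ 2) (+-suc k (suc (k′ + size ks))) ⟨
      σ (1 + k + size (k′ ∷ ks)) ^ 2            ∎)
    ...   | no k≮ = ^2-cancel-< (begin-strict
      (σ (suc k) * starProduct (k′ ∷ ks)) ^ 2     ≡⟨ square-* (σ (suc k)) (starProduct (k′ ∷ ks)) ⟩
      σ (suc k) ^ 2 * starProduct (k′ ∷ ks) ^ 2
        ≤⟨ *-monoʳ-≤ (σ (suc k) ^ 2) (starProduct²-≤ (k′ ∷ ks) (small-parts (k′ ∷ ks) (≰⇒> N≱))) ⟩
      σ (suc k) ^ 2 * S ^ size (k′ ∷ ks)                  ≡⟨ *-comm (σ (suc k) ^ 2) (S ^ size (k′ ∷ ks)) ⟩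
      S ^ size (k′ ∷ ks) * σ (suc k) ^ 2                  <⟨ absorb-< (≤-trans (n≤1+n t) (≮⇒≥ k≮)) (suc (k′ + size ks)) ⟩
      σ (1 + k + size (k′ ∷ ks)) ^ 2                      ∎)

    -- With two or more parts the bound is strict, so equality leaves a single star.
    starProduct-≤ : ∀ ks → 3 + t ≤ size ks →
      starProduct ks ≤ σ (size ks ∸ 1) × (starProduct ks ≡ σ (size ks ∸ 1) → ∃[ k ] ks ≡ k ∷ [])
    starProduct-≤ (k ∷ []) _ = ≤-reflexive (trans (*-identityʳ _) (cong (σ ∘ suc) (sym (+-identityʳ k)))) , λ _ → k , refl
    starProduct-≤ (k ∷ k′ ∷ ks) large =
      let dominated = add-star-< k k′ ks (λ N≥ → proj₁ (starProduct-≤ (k′ ∷ ks) N≥)) large in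
      <⇒≤ dominated , λ eq → contradiction eq (<⇒≢ dominated)

    module _ (strictly-convex : ∀ p → σ (p + 1) * σ (p + 1) < σ p * σ (p + 2)) where

      -- If f(a) = 1 at a = `3 + k` with a < n₀ - 1, then f(a - 1) ≤ 1 and strict log-convexity give
      -- f(a + 1) > 1, although a + 1 is still below n₀.
      equality-at : ∀ k → suc k < 1 + t → σ (2 + k) ^ 2 ≡ S ^ (3 + k) → suc k ≡ t
      equality-at k k<t eq with m≤n⇒m<n∨m≡n (s≤s⁻¹ k<t)
      ... | inj₂ k≡t = k≡t
      ... | inj₁ k<  = contradiction (below (2 + k) (s<s k<)) (<⇒≱ (*-cancelˡ-< (S ^ (2 + k)) _ _ (begin-strict
        S ^ (2 + k) * S ^ (4 + k)            ≡⟨ regroup S (S ^ (2 + k)) ⟩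
        S ^ (3 + k) * S ^ (3 + k)            ≡⟨ cong₂ _*_ eq eq ⟨
        σ (2 + k) ^ 2 * σ (2 + k) ^ 2        ≡⟨ square-* (σ (2 + k)) (σ (2 + k)) ⟨
        (σ (2 + k) * σ (2 + k)) ^ 2          <⟨ ^-monoˡ-< 2 (subst₂ (λ p q → σ p * σ p < σ (1 + k) * σ q)
                                                  (+-comm (1 + k) 1) (+-comm (1 + k) 2) (strictly-convex (1 + k))) ⟩
        (σ (1 + k) * σ (3 + k)) ^ 2          ≡⟨ square-* (σ (1 + k)) (σ (3 + k)) ⟩
        σ (1 + k) ^ 2 * σ (3 + k) ^ 2        ≤⟨ *-monoˡ-≤ (σ (3 + k) ^ 2) (below k (<-trans (n<1+n k) k<t)) ⟩
        S ^ (2 + k) * σ (3 + k) ^ 2          ∎)))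
        where
        regroup : ∀ a b → b * (a * (a * b)) ≡ (a * b) * (a * b)
        regroup = solve-∀

      -- A tight part other than an edge has n₀ - 1 vertices. Every further part has at least 2, so
      -- none fits below n₀.
      equality-parts : ∀ ks → size ks < 3 + t → All (λ k → σ (suc k) ^ 2 ≡ S ^ (2 + k)) ks →
        All (_≡ 0) ks ⊎ ks ≡ t ∷ []
      equality-parts [] _ _ = inj₁ []
      equality-parts (zero ∷ ks) lt (_ ∷ eqs)
        with equality-parts ks (≤-<-trans (m≤n+m (size ks) 2) lt) eqs
      ... | inj₁ zeros = inj₁ (refl ∷ zeros)
      ... | inj₂ refl  = contradiction lt (≤⇒≯ (s≤s (s≤s (s≤s (≤-trans (m≤m+n t 0) (n≤1+n (t + 0)))))))
      equality-parts (suc k ∷ ks) lt (eq ∷ _)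
        with equality-at k (s<s⁻¹ (s<s⁻¹ (≤-<-trans (m≤m+n (3 + k) (size ks)) lt))) eq
      equality-parts (suc k ∷ []) lt (eq ∷ _) | refl = inj₂ refl
      equality-parts (suc k ∷ _ ∷ ks) lt (eq ∷ _) | refl =
        contradiction lt (≤⇒≯ (s≤s (s≤s (s≤s (≤-trans (≤-reflexive (+-comm 1 k)) (+-monoʳ-≤ k (s≤s z≤n)))))))

-- Bernoulli's inequality (1 + 1/s)^j ≥ 1 + j/s, cleared of denominators.
bernoulli : ∀ s j → s ^ j * (s + j) ≤ s * suc s ^ j
bernoulli s zero    = ≤-reflexive (trans (+-identityʳ (s + 0)) (trans (+-identityʳ s) (sym (*-identityʳ s))))
bernoulli s (suc j) = begin
  s * s ^ j * (s + suc j)             ≤⟨ m≤m+n _ (s ^ j * j) ⟩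
  s * s ^ j * (s + suc j) + s ^ j * j ≡⟨ regroup s (s ^ j) j ⟩
  suc s * (s ^ j * (s + j))           ≤⟨ *-monoʳ-≤ (suc s) (bernoulli s j) ⟩
  suc s * (s * suc s ^ j)             ≡⟨ swap (suc s) s (suc s ^ j) ⟩
  s * (suc s * suc s ^ j)             ∎
  where
  open ≤-Reasoning
  regroup : ∀ s x j → s * x * (s + suc j) + x * j ≡ suc s * (x * (s + j))
  regroup = solve-∀
  swap : ∀ a b c → a * (b * c) ≡ b * (a * c)
  swap = solve-∀

eventually-dominates : ∀ s → 0 < s → ∃[ j ] s ^ (3 + j) < suc s ^ (2 + j)
-- The witness makes the exponent `2 + s * s`, large enough for the Bernoulli factor `s + j` to
-- exceed `s * s`.
eventually-dominates s s>0 = s * s , *-cancelˡ-< s _ _ (begin-strict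
  s * (s * s ^ j)      ≡⟨ regroup s (s ^ j) ⟩
  s ^ j * (s * s)      <⟨ *-monoʳ-< (s ^ j) {{m^n≢0 s j {{>-nonZero s>0}}}} (≤-trans (n<1+n (s * s)) (≤-trans (n≤1+n _) (m≤n+m j s))) ⟩
  s ^ j * (s + j)      ≤⟨ bernoulli s j ⟩
  s * suc s ^ j        ∎)
  where
  open ≤-Reasoning
  j = 2 + s * s
  regroup : ∀ s x → s * (s * x) ≡ x * (s * s)
  regroup = solve-∀

least : {P : ℕ → Set} → Unary.Decidable P → ∀ {k} → P k → ∃[ j ] P j × (∀ i → i < j → ¬ P i)
least {P} P? {k} Pk with P? 0
... | yes P0 = 0 , P0 , λ _ ()
least {P} P? {zero}  Pk | no ¬P0 = contradiction Pk ¬P0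
least {P} P? {suc k} Pk | no ¬P0 with least {P ∘ suc} (P? ∘ suc) Pk
... | j , Pj , min = suc j , Pj , λ { zero _ → ¬P0 ; (suc i) (s<s i<j) → min i i<j }

-- Degrees and rigidity

⊕-spanning : ∀ {a′ b′} {E : SimpleGraph a} {E′ : SimpleGraph b} {F : SimpleGraph a′} {F′ : SimpleGraph b′} →
  Spanning E F → Spanning E′ F′ → Spanning (E ⊕ E′) (F ⊕ F′)
⊕-spanning {a} {b} {a′} {b′} {E} {E′} {F} {F′} ι ι′ = record { vertices = ↔-sym Fin.+↔⊎ ↔-∘ (φ ↔-∘ Fin.+↔⊎) ; edges = edge }
  where
  φ : (Fin a ⊎ Fin b) ↔ (Fin a′ ⊎ Fin b′)
  φ = Spanning.vertices ι ⊎-↔ Spanning.vertices ι′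
  place⊕ : Fin (a + b) → Fin (a′ + b′)
  place⊕ u = join a′ b′ (Inverse.to φ (splitAt a u))
  edge : ∀ u v → Adj (graph (E ⊕ E′)) u v → Adj (graph (F ⊕ F′)) (place⊕ u) (place⊕ v)
  edge u v u~v with splitAt a u | splitAt a v
  ... | inj₁ i | inj₁ j
    rewrite Fin.splitAt-↑ˡ a′ (Spanning.to ι i) b′ | Fin.splitAt-↑ˡ a′ (Spanning.to ι j) b′ = Spanning.edges ι i j u~v
  ... | inj₂ i | inj₂ j
    rewrite Fin.splitAt-↑ʳ a′ b′ (Spanning.to ι′ i) | Fin.splitAt-↑ʳ a′ b′ (Spanning.to ι′ j) = Spanning.edges ι′ i j u~v

-- `forest (k ∷ [])` is a star together with an empty graph; this discards the empty summand, since
-- `a + 0` does not reduce to `a`.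
⊕-K₀-spanning : (G : SimpleGraph a) → Spanning G (G ⊕ K 0)
⊕-K₀-spanning {a} G = record
  { vertices = mk↔ₛ′ (_↑ˡ 0) ([ id , (λ ()) ]′ ∘ splitAt a) right (λ i → cong [ id , (λ ()) ]′ (Fin.splitAt-↑ˡ a i 0))
  ; edges = edge
  }
  where
  right : ∀ i → [ id , (λ ()) ]′ (splitAt a i) ↑ˡ 0 ≡ i
  right i with splitAt a i in eq
  ... | inj₁ j = Fin.splitAt⁻¹-↑ˡ eq
  edge : ∀ u v → Adj (graph G) u v → Adj (graph (G ⊕ K 0)) (u ↑ˡ 0) (v ↑ˡ 0)
  edge u v u~v rewrite Fin.splitAt-↑ˡ a u 0 | Fin.splitAt-↑ˡ a v 0 = u~v

matching-spanning : ∀ {ks} → All (_≡ 0) ks → Spanning (copies (length ks) (K 2)) (forest ks)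
matching-spanning []                      = record { vertices = ↔-id _ ; edges = λ () }
matching-spanning {_ ∷ ks} (refl ∷ zeros) = Spanning-trans
  (≅⇒Spanning (copies (suc (length ks)) (K 2)) (K 2 ⊕ copies (length ks) (K 2)) (copies-suc (length ks) (K 2)))
  (⊕-spanning (≅⇒Spanning (K 2) K[ 1 , 1 ] K₂≅K₁₁) (matching-spanning zeros))

halfK₂ : {G : SimpleGraph n} → ∀ k → graph G ≅ graph (copies k (K 2)) → IsHalfK₂ G
halfK₂ k e = divides k (↔⇒≡ (_≅_.vertices e)) , e

isStar : {G : SimpleGraph n} → graph G ≅ graph K[ 1 , suc k ] → IsStar G
isStar e with refl ← ↔⇒≡ (_≅_.vertices e) = e

hom-halfK₂ : {G : SimpleGraph n} → IsHalfK₂ G → (H : Graph m) → hom G H ^ 2 ≡ powerSum H 1 ^ n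
hom-halfK₂ {n} {G = G} (divides q n≡q*2 , e) H = begin
  hom G H ^ 2                  ≡⟨ cong (_^ 2) (hom-≅ G (copies q (K 2)) e H) ⟩
  hom (copies q (K 2)) H ^ 2   ≡⟨ cong (_^ 2) (hom-copies q (K 2) H) ⟩
  (hom (K 2) H ^ q) ^ 2        ≡⟨ ^-*-assoc (hom (K 2) H) q 2 ⟩
  hom (K 2) H ^ (q * 2)        ≡⟨ cong₂ _^_ (hom-K₂ H) (sym n≡q*2) ⟩
  powerSum H 1 ^ n             ∎
  where open ≡-Reasoning

hom-isStar : {G : SimpleGraph n} → IsStar G → (H : Graph m) → hom G H ≡ powerSum H (n ∸ 1)
hom-isStar {n} {G = G} e H = trans (hom-≅ G K[ 1 , n ∸ 1 ] e H) (hom-star H (n ∸ 1))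

module _ (H : Graph m) where

  neighbour? : ∀ v → Dec (∃[ w ] Adj H v w)
  neighbour? v = Fin.any? (adj? H v)

  degree-sum : ∀ v → degree H v ≡ ∑[ w < m ] indicator (adj? H v w)
  degree-sum v = countFin-sum (adj? H v)

  degree>0⇒neighbour : ∀ v → 0 < degree H v → ∃[ w ] Adj H v w
  degree>0⇒neighbour v d>0 = decidable-stable (neighbour? v) λ none → <⇒≱ d>0 (begin
    degree H v                            ≡⟨ degree-sum v ⟩
    ∑[ w < m ] indicator (adj? H v w)     ≤⟨ sum-mono-≤ (λ w → indicator-mono (adj? H v w) (no id) (λ v~w → none (w , v~w))) ⟩
    ∑[ w < m ] 0                          ≡⟨ sum-replicate-zero m ⟩
    0                                     ∎)
    where open ≤-Reasoning

  degree-mono : ∀ v w → (∀ x → Adj H v x → Adj H w x) → degree H v ≤ degree H w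
  degree-mono v w N⊆ = subst₂ _≤_ (sym (degree-sum v)) (sym (degree-sum w))
    (sum-mono-≤ λ x → indicator-mono (adj? H v x) (adj? H w x) (N⊆ x))

  degree-≤ : ∀ v → degree H v ≤ m
  degree-≤ v = Vec.count≤n (adj? H v) (Vec.allFin m)

  degree-< : ∀ {v w} → ¬ Adj H v w → degree H v < m
  degree-< {v} {w} v≁w = subst₂ _<_ (sym (degree-sum v)) (trans (sum-const m 1) (*-identityʳ m))
    (sum-mono-< (λ x → indicator-mono (adj? H v x) (yes tt) _) w (indicator-< (adj? H v w) (yes tt) v≁w tt))

  degree-full : ∀ {v} → (∀ w → Adj H v w) → m ≤ degree H v
  degree-full {v} full = subst₂ _≤_ (trans (sum-const m 1) (*-identityʳ m)) (sym (degree-sum v))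
    (sum-mono-≤ λ w → indicator-mono (yes tt) (adj? H v w) λ _ → full w)

  Δ : ℕ
  Δ = maxDegree H

  degree≤Δ : ∀ v → degree H v ≤ Δ
  degree≤Δ v = All.lookup (xs≤max 0 (List.map (degree H) (allFin m))) (∈-map⁺ (degree H) (∈-allFin v))

  Δ≤m : Δ ≤ m
  Δ≤m = max≤v⁺ {xs = List.map (degree H) (allFin m)} z≤n (All.map⁺ (All.tabulate λ {v} _ → degree-≤ v))

  Δ-attained : 0 < Δ → ∃[ v ] degree H v ≡ Δ
  Δ-attained Δ>0 with argmax-sel id 0 (List.map (degree H) (allFin m))
  ... | inj₁ Δ≡0 = contradiction Δ≡0 (>⇒≢ Δ>0)
  ... | inj₂ Δ∈ = let v , _ , Δ≡ = ∈-map⁻ (degree H) Δ∈ in v , sym Δ≡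

  looped-complete : (∀ v w → Adj H v w) → H ≅ Kˡᵒᵒᵖ Δ
  looped-complete full = subst (λ k → H ≅ Kˡᵒᵒᵖ k) (sym (≤-antisym Δ≤m (m≤Δ m refl)))
    record { vertices = ↔-id _ ; adjacent = λ v w → mk⇔ _ λ _ → full v w }
    where
    -- The copy `k` allows a case split on the order of `H`: with no vertices the bound is trivial,
    -- otherwise `zero` has full degree.
    m≤Δ : ∀ k → k ≡ m → m ≤ Δ
    m≤Δ zero    refl = z≤n
    m≤Δ (suc _) refl = ≤-trans (degree-full (full zero)) (degree≤Δ zero)

  regular-sum : (∀ v → Δ ≤ degree H v) → m * Δ ≤ powerSum H 1
  regular-sum regular = begin
    m * Δ           ≡⟨ sum-const m Δ ⟨
    ∑[ v < m ] Δ    ≤⟨ sum-mono-≤ (λ v → ≤-trans (regular v) (≤-reflexive (sym (*-identityʳ (degree H v))))) ⟩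
    powerSum H 1    ∎
    where open ≤-Reasoning

  irregular? : Dec (∃[ u ] degree H u < Δ)
  irregular? = Fin.any? λ u → degree H u <? Δ

  powerSum-suc : ∀ k → powerSum H (suc k) ≡ ∑[ v < m ] (degree H v ^ k * degree H v ^ 1)
  powerSum-suc k = sum-cong-≗ λ v → trans (*-comm (degree H v) (degree H v ^ k))
    (cong (degree H v ^ k *_) (sym (*-identityʳ (degree H v))))

  powerSum-≤ : ∀ k → powerSum H (suc k) ≤ Δ ^ k * powerSum H 1
  powerSum-≤ k = subst₂ _≤_ (sym (powerSum-suc k)) (sym (*-distribˡ-sum (Δ ^ k) (λ v → degree H v ^ 1)))
    (sum-mono-≤ λ v → *-monoˡ-≤ (degree H v ^ 1) (^-monoˡ-≤ k (degree≤Δ v)))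

  powerSum-max : ∀ p → 0 < Δ → Δ ^ p ≤ powerSum H p
  powerSum-max p Δ>0 = let v , dv≡Δ = Δ-attained Δ>0 in
    subst (λ d → d ^ p ≤ powerSum H p) dv≡Δ (member v)
    where
    member : ∀ {n} {f : Fin n → ℕ} i → f i ≤ sum f
    member {f = f} zero    = m≤m+n (f zero) _
    member {f = f} (suc i) = ≤-trans (member i) (m≤n+m _ (f zero))

  module _ (neighbour-of : ∀ v → ∃[ w ] Adj H v w) where

    degree>0 : ∀ v → 0 < degree H v
    degree>0 v = let w , v~w = neighbour-of v in subst₂ _<_ (sum-replicate-zero m) (sym (degree-sum v))
      (sum-mono-< {f = λ _ → 0} (λ _ → z≤n) w (indicator-< (no id) (adj? H v w) id v~w))

    powerSum>0 : Fin m → ∀ p → 0 < powerSum H p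
    powerSum>0 v p = subst (_< powerSum H p) (sum-replicate-zero m)
      (sum-mono-< {f = λ _ → 0} (λ _ → z≤n) v (m^n>0 (degree H v) {{>-nonZero (degree>0 v)}} p))

    powerSum-< : ∀ k {u} → degree H u < Δ → powerSum H (2 + k) < Δ ^ suc k * powerSum H 1
    powerSum-< k {u} du<Δ = subst₂ _<_ (sym (powerSum-suc (suc k))) (sym (*-distribˡ-sum (Δ ^ suc k) (λ v → degree H v ^ 1)))
      (sum-mono-< (λ v → *-monoˡ-≤ (degree H v ^ 1) (^-monoˡ-≤ (suc k) (degree≤Δ v))) u
        (*-monoˡ-< (degree H u ^ 1) {{m^n≢0 (degree H u) 1 {{>-nonZero (degree>0 u)}}}} (^-monoˡ-< (suc k) du<Δ)))

    square-bound : ∀ k S → (Δ ^ k * S) ^ 2 ≡ (Δ ^ 2) ^ k * S ^ 2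
    square-bound k S = trans (square-* (Δ ^ k) S) (cong (_* S ^ 2)
      (trans (^-*-assoc Δ k 2) (trans (cong (Δ ^_) (*-comm k 2)) (sym (^-*-assoc Δ 2 k)))))

    -- All but one factor of each degree power is bounded by Δ, and then Δ² by the degree sum. The
    -- first step is strict if some degree is below Δ. Otherwise `H` is regular, and the
    -- non-adjacent pair gives Δ < m, so the degree sum mΔ exceeds Δ².
    stars-below-edges : ∀ {x y} → ¬ Adj H x y → Δ ^ 2 ≤ powerSum H 1 →
      ∀ k → powerSum H (2 + k) ^ 2 < powerSum H 1 ^ (3 + k)
    stars-below-edges {x} {y} x≁y Δ²≤S k with irregular?
    ... | yes (u , du<Δ) = begin-strict
      powerSum H (2 + k) ^ 2              <⟨ ^-monoˡ-< 2 (powerSum-< k du<Δ) ⟩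
      (Δ ^ suc k * powerSum H 1) ^ 2      ≡⟨ square-bound (suc k) (powerSum H 1) ⟩
      (Δ ^ 2) ^ suc k * powerSum H 1 ^ 2  ≤⟨ *-monoˡ-≤ (powerSum H 1 ^ 2) (^-monoˡ-≤ (suc k) Δ²≤S) ⟩
      powerSum H 1 ^ suc k * powerSum H 1 ^ 2 ≡⟨ ^-distribˡ-+-* (powerSum H 1) (suc k) 2 ⟨
      powerSum H 1 ^ (suc k + 2)          ≡⟨ cong (powerSum H 1 ^_) (+-comm (suc k) 2) ⟩
      powerSum H 1 ^ (3 + k)              ∎
      where open ≤-Reasoning
    ... | no regular = begin-strict
      powerSum H (2 + k) ^ 2              ≤⟨ ^-monoˡ-≤ 2 (powerSum-≤ (suc k)) ⟩
      (Δ ^ suc k * powerSum H 1) ^ 2      ≡⟨ square-bound (suc k) (powerSum H 1) ⟩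
      (Δ ^ 2) ^ suc k * powerSum H 1 ^ 2  <⟨ *-monoˡ-< (powerSum H 1 ^ 2)
                                               {{m^n≢0 (powerSum H 1) 2 {{>-nonZero (powerSum>0 x 1)}}}}
                                               (^-monoˡ-< (suc k) Δ²<S) ⟩
      powerSum H 1 ^ suc k * powerSum H 1 ^ 2 ≡⟨ ^-distribˡ-+-* (powerSum H 1) (suc k) 2 ⟨
      powerSum H 1 ^ (suc k + 2)          ≡⟨ cong (powerSum H 1 ^_) (+-comm (suc k) 2) ⟩
      powerSum H 1 ^ (3 + k)              ∎
      where
      open ≤-Reasoning
      Δ≤degree : ∀ v → Δ ≤ degree H v
      Δ≤degree v = ≮⇒≥ λ dv<Δ → regular (v , dv<Δ)
      Δ²<S : Δ ^ 2 < powerSum H 1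
      Δ²<S = begin-strict
        Δ ^ 2          ≡⟨ cong (Δ *_) (*-identityʳ Δ) ⟩
        Δ * Δ          <⟨ *-monoˡ-< Δ {{>-nonZero (<-≤-trans (degree>0 x) (degree≤Δ x))}}
                            (≤-<-trans (Δ≤degree x) (degree-< x≁y)) ⟩
        m * Δ          ≤⟨ regular-sum Δ≤degree ⟩
        powerSum H 1   ∎

    -- Non-adjacent distinct vertices lie in different copies, so they can be sent to `x` and `y`
    -- independently, with their partners going to chosen neighbours.
    matching-rigid : ∀ {x y} → ¬ Adj H x y → ∀ k → Rigid (copies k (K 2)) H
    matching-rigid {x} {y} x≁y k u v u≢v u≁v = f , hom-f , λ fu~fv → x≁y (subst₂ (Adj H) fu≡x fv≡y fu~fv)
      where
      copy : Fin (k * 2) → Fin k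
      copy = quotient 2
      vertex : Fin (k * 2) → Fin 2
      vertex = remainder {k} 2
      edgeAt : Fin 2 → Fin m → Fin 2 → Fin m
      edgeAt i z j with i Fin.≟ j
      ... | yes _ = z
      ... | no  _ = proj₁ (neighbour-of z)
      edgeAt-self : ∀ i z → edgeAt i z i ≡ z
      edgeAt-self i z with i Fin.≟ i
      ... | yes _  = refl
      ... | no i≢i = contradiction refl i≢i
      edgeAt-hom : ∀ i z → IsHom (K 2) H (edgeAt i z)
      edgeAt-hom i z j j′ j≢j′ with i Fin.≟ j | i Fin.≟ j′
      ... | yes refl | yes refl = contradiction refl j≢j′
      ... | yes _    | no _     = proj₂ (neighbour-of z)
      ... | no _     | yes _    = adj-sym H (proj₂ (neighbour-of z))
      edgeAt-hom zero z zero j′ j≢j′ | no i≢j | no _ = contradiction refl i≢j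
      edgeAt-hom zero z (suc zero) zero j≢j′ | no _ | no i≢j′ = contradiction refl i≢j′
      edgeAt-hom zero z (suc zero) (suc zero) j≢j′ | no _ | no _ = contradiction refl j≢j′
      edgeAt-hom (suc zero) z (suc zero) j′ j≢j′ | no i≢j | no _ = contradiction refl i≢j
      edgeAt-hom (suc zero) z zero (suc zero) j≢j′ | no _ | no i≢j′ = contradiction refl i≢j′
      edgeAt-hom (suc zero) z zero zero j≢j′ | no _ | no _ = contradiction refl j≢j′
      copies-differ : ¬ copy u ≡ copy v
      copies-differ same = u≁v (same , λ same′ → u≢v (begin
        u                               ≡⟨ Fin.combine-remQuot {k} 2 u ⟨
        combine (copy u) (vertex u)     ≡⟨ cong₂ combine same same′ ⟩
        combine (copy v) (vertex v)     ≡⟨ Fin.combine-remQuot {k} 2 v ⟩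
        v                               ∎))
        where open ≡-Reasoning
      -- All copies except that of `u` receive the map made for `v`, so no third case arises.
      onCopy : Fin k → Fin 2 → Fin m
      onCopy c with c Fin.≟ copy u
      ... | yes _ = edgeAt (vertex u) x
      ... | no  _ = edgeAt (vertex v) y
      onCopy-hom : ∀ c → IsHom (K 2) H (onCopy c)
      onCopy-hom c with c Fin.≟ copy u
      ... | yes _ = edgeAt-hom (vertex u) x
      ... | no  _ = edgeAt-hom (vertex v) y
      f : Fin (k * 2) → Fin m
      f w = onCopy (copy w) (vertex w)
      hom-f : IsHom (copies k (K 2)) H f
      hom-f w w′ (same , w~w′) = subst (λ c → Adj H (f w) (onCopy c (vertex w′))) same
        (onCopy-hom (copy w) (vertex w) (vertex w′) w~w′)
      fu≡x : f u ≡ x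
      fu≡x with copy u Fin.≟ copy u
      ... | yes _  = edgeAt-self (vertex u) x
      ... | no u≢u = contradiction refl u≢u
      fv≡y : f v ≡ y
      fv≡y with copy v Fin.≟ copy u
      ... | yes same = contradiction (sym same) copies-differ
      ... | no _     = edgeAt-self (vertex v) y

  -- A non-adjacent pair consists of two leaves. The centre goes to `z`, the first of these leaves
  -- to `x`, and every other leaf to `y`.
  star-rigid : ∀ {x y z} → Adj H z x → Adj H z y → ¬ Adj H x y → ∀ k → Rigid K[ 1 , k ] H
  star-rigid z~x z~y x≁y k zero    zero    u≢v u≁v = contradiction refl u≢v
  star-rigid z~x z~y x≁y k zero    (suc j) u≢v u≁v = contradiction tt u≁v
  star-rigid z~x z~y x≁y k (suc i) zero    u≢v u≁v = contradiction tt u≁v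
  star-rigid {x} {y} {z} z~x z~y x≁y k (suc i) (suc j) u≢v u≁v =
    f , hom-f , λ fu~fv → x≁y (subst₂ (Adj H) fi≡x fj≡y fu~fv)
    where
    leaf : Fin k → Fin m
    leaf l with l Fin.≟ i
    ... | yes _ = x
    ... | no  _ = y
    f : Fin (1 + k) → Fin m
    f zero    = z
    f (suc l) = leaf l
    z~leaf : ∀ l → Adj H z (leaf l)
    z~leaf l with l Fin.≟ i
    ... | yes _ = z~x
    ... | no  _ = z~y
    hom-f : IsHom K[ 1 , k ] H f
    hom-f zero    (suc l) _ = z~leaf l
    hom-f (suc l) zero    _ = adj-sym H (z~leaf l)
    fi≡x : leaf i ≡ x
    fi≡x with i Fin.≟ i
    ... | yes _  = refl
    ... | no i≢i = contradiction refl i≢i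
    fj≡y : leaf j ≡ y
    fj≡y with j Fin.≟ i
    ... | yes j≡i = contradiction (cong suc (sym j≡i)) u≢v
    ... | no _    = refl

  module _ (S<Δ² : powerSum H 1 < Δ ^ 2) where

    Δ²≡Δ*Δ : Δ ^ 2 ≡ Δ * Δ
    Δ²≡Δ*Δ = cong (Δ *_) (*-identityʳ Δ)

    Δ>0 : 0 < Δ
    Δ>0 = n≢0⇒n>0 λ Δ≡0 → n≮0 (subst (λ d → powerSum H 1 < d ^ 2) Δ≡0 S<Δ²)

    -- A Δ-regular `H` has degree sum mΔ, which is at least Δ² because Δ ≤ m.
    irregular : ∃[ u ] degree H u < Δ
    irregular = decidable-stable irregular? λ regular → <⇒≱ S<Δ² (begin
      Δ ^ 2         ≡⟨ Δ²≡Δ*Δ ⟩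
      Δ * Δ         ≤⟨ *-monoˡ-≤ Δ Δ≤m ⟩
      m * Δ         ≤⟨ regular-sum (λ v → ≮⇒≥ λ dv<Δ → regular (v , dv<Δ)) ⟩
      powerSum H 1  ∎)
      where open ≤-Reasoning

    -- If any two neighbours of a vertex of degree Δ were adjacent, then its Δ
    -- neighbours would all have degree Δ, and the degree sum would reach Δ².
    open-path : ∃[ z ] ∃[ x ] ∃[ y ] Adj H z x × Adj H z y × ¬ Adj H x y
    open-path = decidable-stable
      (Fin.any? λ z → Fin.any? λ x → Fin.any? λ y → adj? H z x ×-dec adj? H z y ×-dec ¬? (adj? H x y))
      λ none →
        let v , dv≡Δ = Δ-attained Δ>0
            clique : ∀ x → Adj H v x → degree H v ≤ degree H x
            clique x v~x = degree-mono v x λ y v~y → decidable-stable (adj? H x y) λ x≁y → none (v , x , y , v~x , v~y , x≁y)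
            open ≤-Reasoning
        in <⇒≱ S<Δ² (begin
          Δ ^ 2                                           ≡⟨ Δ²≡Δ*Δ ⟩
          Δ * Δ                                           ≡⟨ cong₂ _*_ dv≡Δ dv≡Δ ⟨
          degree H v * degree H v                         ≡⟨ cong (_* degree H v) (degree-sum v) ⟩
          sum (λ x → indicator (adj? H v x)) * degree H v ≡⟨ *-distribʳ-sum (degree H v) (λ x → indicator (adj? H v x)) ⟩
          ∑[ x < m ] (indicator (adj? H v x) * degree H v)
            ≤⟨ sum-mono-≤ (λ x → term (adj? H v x) (clique x)) ⟩
          powerSum H 1                                    ∎)
      where
      term : ∀ {v x} (d : Dec (Adj H v x)) → (Adj H v x → degree H v ≤ degree H x) →
        indicator d * degree H v ≤ degree H x ^ 1
      term         (no _)    _  = z≤n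
      term {v} {x} (yes v~x) le = subst₂ _≤_ (sym (+-identityʳ (degree H v))) (sym (*-identityʳ (degree H x))) (le v~x)

    -- This makes n₀ exist. A vertex of maximum degree alone contributes Δ^(2 + j), and Δ² is at
    -- least S + 1, so it suffices that (S + 1)^(2 + j) outgrows S^(3 + j).
    star-beats-edges : 0 < powerSum H 1 → ∃[ j ] powerSum H 1 ^ (3 + j) < powerSum H (2 + j) ^ 2
    star-beats-edges S>0 = let j , S< = eventually-dominates (powerSum H 1) S>0 in j , (begin-strict
      powerSum H 1 ^ (3 + j)       <⟨ S< ⟩
      suc (powerSum H 1) ^ (2 + j) ≤⟨ ^-monoˡ-≤ (2 + j) S<Δ² ⟩
      (Δ ^ 2) ^ (2 + j)            ≡⟨ ^-*-assoc Δ 2 (2 + j) ⟩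
      Δ ^ (2 * (2 + j))            ≡⟨ cong (Δ ^_) (*-comm 2 (2 + j)) ⟩
      Δ ^ ((2 + j) * 2)            ≡⟨ ^-*-assoc Δ (2 + j) 2 ⟨
      (Δ ^ (2 + j)) ^ 2            ≤⟨ ^-monoˡ-≤ 2 (powerSum-max (2 + j) Δ>0) ⟩
      powerSum H (2 + j) ^ 2       ∎)
      where open ≤-Reasoning

-- The bounds for G and their equality cases

squeeze : ∀ {x y z : ℕ} → x ≤ y → y ^ 2 ≤ z → x ^ 2 ≡ z → x ≡ y × y ^ 2 ≡ z
squeeze x≤y y²≤z x²≡z with m≤n⇒m<n∨m≡n x≤y
... | inj₁ x<y  = contradiction x²≡z (<⇒≢ (<-≤-trans (^-monoˡ-< 2 x<y) y²≤z))
... | inj₂ refl = refl , x²≡z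

module _ (H : Graph m) {G : SimpleGraph n} (ks : List ℕ) (ι : Spanning (forest ks) G) where

  hom-≤-starHoms : hom G H ≤ starHoms H ks
  hom-≤-starHoms = ≤-trans (hom-≤ ι H) (≤-reflexive (hom-forest ks H))

  -- When all parts are edges the forest is a perfect matching, and rigidity turns equal counts into
  -- an isomorphism.
  matching-case : (∀ k → Rigid (copies k (K 2)) H) → All (_≡ 0) ks → hom G H ≡ starHoms H ks → IsHalfK₂ G
  matching-case rigid zeros eq = halfK₂ {G = G} (length ks)
    (rigid-≅ {H = H} (rigid (length ks)) (Spanning-trans (matching-spanning zeros) ι)
      (trans eq (trans (zero-parts zeros) (sym (hom-copies (length ks) (K 2) H)))))
    where
    zero-parts : ∀ {ks} → All (_≡ 0) ks → starHoms H ks ≡ hom (K 2) H ^ length ks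
    zero-parts []             = refl
    zero-parts (refl ∷ zeros) = cong₂ _*_ (sym (hom-K₂ H)) (zero-parts zeros)

  star-case : (∀ k → Rigid K[ 1 , k ] H) → ks ≡ k ∷ [] → hom G H ≡ starHoms H ks → IsStar G
  star-case {k} rigid refl eq = isStar {G = G}
    (rigid-≅ {H = H} (rigid (suc k)) (Spanning-trans (⊕-K₀-spanning K[ 1 , suc k ]) ι)
      (trans eq (trans (*-identityʳ _) (sym (hom-star H (suc k))))))

neighbours : (G : SimpleGraph n) → HasMinDegree (graph G) 1 → ∀ v → ∃[ w ] Adj (graph G) v w
neighbours G (δ≤ , _) v = degree>0⇒neighbour (graph G) v (δ≤ v)

module _ (H : Graph m) (neighbour-of : ∀ v → ∃[ w ] Adj H v w) where

  private
    S = powerSum H 1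
    σ = powerSum H
    module Degrees = PowerSums (degree H)

  edge-part : ∀ {x y} → ¬ Adj H x y → Δ H ^ 2 ≤ S → (G : SimpleGraph n) → HasMinDegree (graph G) 1 →
    hom G H ^ 2 ≤ S ^ n × (hom G H ^ 2 ≡ S ^ n ⇔ IsHalfK₂ G)
  edge-part {x = x} x≁y Δ²≤S G δ with ks , ι ← spanningForest G (neighbours G δ)
    -- The vertex bijection identifies `n` with `size ks`.
    with refl ← ↔⇒≡ (Spanning.vertices ι) =
    ≤-trans (^-monoˡ-≤ 2 (hom-≤-starHoms H ks ι)) (starProduct²-≤ ks small) ,
    mk⇔ (λ eq → let same , tight = squeeze (hom-≤-starHoms H ks ι) (starProduct²-≤ ks small) eq in
          matching-case H ks ι (matching-rigid H neighbour-of x≁y)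
            (All.map (λ {k} → edge-only k) (starProduct²-≡ ks small tight)) same)
        (λ half → hom-halfK₂ {G = G} half H)
    where
    open StarProducts σ (powerSum>0 H neighbour-of x) Degrees.σ-spread using (starProduct²-≤; starProduct²-≡)
    bound : ∀ k → σ (suc k) ^ 2 ≤ S ^ (2 + k)
    bound zero    = ≤-refl
    bound (suc k) = <⇒≤ (stars-below-edges H neighbour-of x≁y Δ²≤S k)
    small = All.tabulate λ {k} _ → bound k
    edge-only : ∀ k → σ (suc k) ^ 2 ≡ S ^ (2 + k) → k ≡ 0
    edge-only zero    _  = refl
    edge-only (suc k) eq = contradiction eq (<⇒≢ (stars-below-edges H neighbour-of x≁y Δ²≤S k))

  -- The inequality of `StarBeatsEdges` at `3 + t`, in power sums; the shift by 3 builds in the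
  -- lower bound on n₀.
  Beats : ℕ → Set
  Beats t = S ^ (3 + t) < σ (2 + t) ^ 2

  opaque

    threshold : S < Δ H ^ 2 → ∃[ t ] Beats t × (∀ i → i < t → ¬ Beats i)
    threshold S<Δ² =
      let v , _ = Δ-attained H (Δ>0 H S<Δ²)
          j , beats = star-beats-edges H S<Δ² (powerSum>0 H neighbour-of v 1)
      in least {P = Beats} (λ t → S ^ (3 + t) <? σ (2 + t) ^ 2) {j} beats

  module StarPart (S<Δ² : S < Δ H ^ 2) (t : ℕ) (beats : Beats t) (minimal : ∀ i → i < t → ¬ Beats i) where

    private
      top = Δ-attained H (Δ>0 H S<Δ²)
      path = open-path H S<Δ²
      z~x = proj₁ (proj₂ (proj₂ (proj₂ path)))
      z~y = proj₁ (proj₂ (proj₂ (proj₂ (proj₂ path))))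
      x≁y = proj₂ (proj₂ (proj₂ (proj₂ (proj₂ path))))

    open StarProducts σ (powerSum>0 H neighbour-of (proj₁ top)) Degrees.σ-spread using (starProduct²-≤; starProduct²-≡; module Threshold)

    below : ∀ k → k < 1 + t → σ (suc k) ^ 2 ≤ S ^ (2 + k)
    below zero    _         = ≤-refl
    below (suc k) (s<s k<t) = ≮⇒≥ (minimal k k<t)

    open Threshold t beats below

    strictly-convex : ∀ p → σ (p + 1) * σ (p + 1) < σ p * σ (p + 2)
    strictly-convex = let u , du<Δ = irregular H S<Δ² in
      Degrees.σ-spread-< (degree>0 H neighbour-of) u (proj₁ top) (subst (degree H u <_) (sym (proj₂ top)) du<Δ)

    small-part : (G : SimpleGraph n) → HasMinDegree (graph G) 1 → n < 3 + t →
      hom G H ^ 2 ≤ S ^ n × (hom G H ^ 2 ≡ S ^ n ⇔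
        (IsHalfK₂ G ⊎ (n ≡ 2 + t × S ^ (2 + t) ≡ σ (1 + t) ^ 2 × IsStar G)))
    small-part G δ n<n₀ with ks , ι ← spanningForest G (neighbours G δ)
      with refl ← ↔⇒≡ (Spanning.vertices ι) =
      ≤-trans (^-monoˡ-≤ 2 (hom-≤-starHoms H ks ι)) (starProduct²-≤ ks small) ,
      mk⇔ forward backward
      where
      small = small-parts ks n<n₀
      forward : hom G H ^ 2 ≡ S ^ size ks →
        IsHalfK₂ G ⊎ (size ks ≡ 2 + t × S ^ (2 + t) ≡ σ (1 + t) ^ 2 × IsStar G)
      forward eq =
        let same , tight = squeeze (hom-≤-starHoms H ks ι) (starProduct²-≤ ks small) eq
            tights = starProduct²-≡ ks small tight
        in Sum.map
          (λ zeros → matching-case H ks ι (matching-rigid H neighbour-of x≁y) zeros same)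
          (λ ks≡t∷[] → trans (cong size ks≡t∷[]) (+-identityʳ (2 + t)) ,
            sym (All.head (subst (All λ k → σ (suc k) ^ 2 ≡ S ^ (2 + k)) ks≡t∷[] tights)) ,
            star-case H ks ι (star-rigid H z~x z~y x≁y) ks≡t∷[] same)
          (equality-parts strictly-convex ks n<n₀ tights)
      backward : IsHalfK₂ G ⊎ (size ks ≡ 2 + t × S ^ (2 + t) ≡ σ (1 + t) ^ 2 × IsStar G) →
        hom G H ^ 2 ≡ S ^ size ks
      backward (inj₁ half) = hom-halfK₂ {G = G} half H
      backward (inj₂ (n≡ , tight , starG)) = trans
        (cong (_^ 2) (trans (hom-isStar {G = G} starG H) (cong (λ n → σ (n ∸ 1)) n≡)))
        (trans (sym tight) (cong (S ^_) (sym n≡)))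

    large-part : (G : SimpleGraph n) → HasMinDegree (graph G) 1 → 3 + t ≤ n →
      hom G H ≤ σ (n ∸ 1) × (hom G H ≡ σ (n ∸ 1) ⇔ IsStar G)
    large-part G δ n₀≤n with ks , ι ← spanningForest G (neighbours G δ)
      with refl ← ↔⇒≡ (Spanning.vertices ι) =
      let bound , equality = starProduct-≤ ks n₀≤n in
      ≤-trans (hom-≤-starHoms H ks ι) bound ,
      mk⇔ (λ eq →
            -- The star product lies between hom(G,H) and the star bound, so equality of the outer
            -- two makes all three equal.
            let same = ≤-antisym (hom-≤-starHoms H ks ι) (≤-trans bound (≤-reflexive (sym eq)))
                k , ks≡ = equality (trans (sym same) eq)
            in star-case H ks ι (star-rigid H z~x z~y x≁y) ks≡ same)
          (λ starG → hom-isStar {G = G} starG H)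

theorem1p4 : ∀ {m : ℕ} (H : Graph m) → (∀ v → ¬ Isolated H v) →
    ( ¬ (H ≅ Kˡᵒᵒᵖ (maxDegree H)) →
    hom (K 2) H ≥ maxDegree H ^ 2 →
    ∀ {n : ℕ} → 2 ≤ n → (G : SimpleGraph n) → HasMinDegree (graph G) 1 →
    (hom G H ≤ʳ hom (K 2) H ^⟨ n / 2 ⟩)
    × ((hom G H ≡ʳ hom (K 2) H ^⟨ n / 2 ⟩) ⇔ IsHalfK₂ G) )
    ×
    ( hom (K 2) H < maxDegree H ^ 2 →
    ∃[ n₀ ] IsLeast (StarBeatsEdges H) n₀ ×
    (∀ {n : ℕ} → 2 ≤ n → (G : SimpleGraph n) → HasMinDegree (graph G) 1 →
    ( n < n₀ →
    (hom G H ≤ʳ hom (K 2) H ^⟨ n / 2 ⟩)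
    × ((hom G H ≡ʳ hom (K 2) H ^⟨ n / 2 ⟩)
    ⇔ (IsHalfK₂ G
    ⊎ (n ≡ n₀ ∸ 1
    × (hom (K 2) H ≡ʳ hom K[ 1 , n₀ ∸ 2 ] H ^⟨ 2 / n₀ ∸ 1 ⟩)
    × IsStar G))) )
    ×
    ( n₀ ≤ n →
    (hom G H ≤ hom K[ 1 , n ∸ 1 ] H)
    × ((hom G H ≡ hom K[ 1 , n ∸ 1 ] H) ⇔ IsStar G) )) )
theorem1p4 {m} H no-isolated =
  (λ H≇K Δ²≤S {n} _ G δ →
    let x , y , x≁y = non-adjacent H≇K in
    subst (λ s → hom G H ^ 2 ≤ s ^ n × (hom G H ^ 2 ≡ s ^ n ⇔ IsHalfK₂ G)) (sym (hom-K₂ H))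
      (edge-part H neighbour-of x≁y (subst (maxDegree H ^ 2 ≤_) (hom-K₂ H) Δ²≤S) G δ)) ,
  λ edges<Δ² →
    let S<Δ² = subst (_< maxDegree H ^ 2) (hom-K₂ H) edges<Δ²
        t , beats , minimal = threshold H neighbour-of S<Δ²
    in
    -- With this n₀ the truncated differences `n₀ ∸ 1` and `n₀ ∸ 2` compute to `2 + t` and `1 + t`.
    3 + t ,
    ( (s≤s (s≤s (s≤s z≤n)) ,
       subst₂ (λ s s′ → s ^ (3 + t) < s′ ^ 2) (sym (hom-K₂ H)) (sym (hom-star H (2 + t))) beats)
    , λ { _ (s≤s (s≤s (s≤s (z≤n {i}))) , beatsᵢ) → s≤s (s≤s (s≤s (≮⇒≥ λ i<t → minimal i i<t
            (subst₂ (λ s s′ → s ^ (3 + i) < s′ ^ 2) (hom-K₂ H) (hom-star H (2 + i)) beatsᵢ)))) }) ,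
    λ {n} _ G δ →
      (λ n<n₀ → subst₂ (λ s s′ → hom G H ^ 2 ≤ s ^ n × (hom G H ^ 2 ≡ s ^ n ⇔
          (IsHalfK₂ G ⊎ (n ≡ 2 + t × s ^ (2 + t) ≡ s′ ^ 2 × IsStar G))))
        (sym (hom-K₂ H)) (sym (hom-star H (1 + t)))
        (StarPart.small-part H neighbour-of S<Δ² t beats minimal G δ n<n₀)) ,
      (λ n₀≤n → subst (λ s → hom G H ≤ s × (hom G H ≡ s ⇔ IsStar G)) (sym (hom-star H (n ∸ 1)))
        (StarPart.large-part H neighbour-of S<Δ² t beats minimal G δ n₀≤n))
  where
  neighbour-of : ∀ v → ∃[ w ] Adj H v w
  neighbour-of v = decidable-stable (neighbour? H v) λ none → no-isolated v λ w v~w → none (w , v~w)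
  -- The two vertices may coincide, in which case the vertex has no loop.
  non-adjacent : ¬ (H ≅ Kˡᵒᵒᵖ (maxDegree H)) → ∃[ x ] ∃[ y ] ¬ Adj H x y
  non-adjacent H≇K = decidable-stable (Fin.any? λ x → Fin.any? λ y → ¬? (adj? H x y)) λ none →
    H≇K (looped-complete H λ x y → decidable-stable (adj? H x y) λ x≁y → none (x , y , x≁y))
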